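{- Let $n,c\ge 1$ be integers, and put $\ell = nc$ and $m = 2^{(n+1)^{(c+1)n}}$. Let $f:[\{0,1,\dots,(2m-1)^\ell-1\}]^2\to\{0,1,\dots,c-1\}$ be any function, and let $<^*$ be any linear order on $\{0,1,\dots,n-2\}$. Then there are integers $0\le a_0<a_1<\dots<a_{n-1}<(2m-1)^\ell$ such that: (a) $f$ is constant on $[\{a_0,\dots,a_{n-1}\}]^2$; and (b) the differences $b_i := a_{i+1}-a_i$ (for $0\le i<n-1$) are pairwise distinct and are ordered according to $<^*$, i.e. for all $i,j\in\{0,\dots,n-2\}$, $i<^*j$ implies $b_i<b_j$.
   Context: For a set $A$, $[A]^2$ denotes the set of all 2-element subsets of $A$. The set $\{0,1,\dots,n-2\}$ is empty when $n=1$. -}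

module Defs where

open import Data.Nat.Base using (ℕ; zero; suc; pred; _∸_)
open import Data.Fin.Base using (Fin; suc; inject₁; toℕ)
open import Data.Fin.Subset using (Subset; ∣_∣; _∈_)
open import Data.Product.Base using (∃; _,_)
open import Level using (0ℓ)
open import Relation.Binary.PropositionalEquality.Core using (_≡_)
open import Relation.Unary using (Pred; _⊆_)

-- The 2-element subsets of {0,…,N-1}.  Since equality proofs in ℕ are
-- unique, two elements of this type are equal iff the subsets are equal.
[_]² : ℕ → Set
[ N ]² = ∃ λ (p : Subset N) → ∣ p ∣ ≡ 2

Range : ∀ {n N} → (Fin n → Fin N) → Pred (Fin N) 0ℓ
Range a x = ∃ λ i → a i ≡ x

-- f is constant on [A]², i.e. on the 2-element subsets contained in A.
ConstantOnPairs : ∀ {N c} → ([ N ]² → Fin c) → Pred (Fin N) 0ℓ → Set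
ConstantOnPairs {N} f A = (s t : [ N ]²) → s ⊆A → t ⊆A → f s ≡ f t
  where
  _⊆A : [ N ]² → Set
  (p , _) ⊆A = (_∈ p) ⊆ A

-- The consecutive differences a (i+1) - a i for 0 ≤ i < n-1.  Truncated
-- subtraction is exact because this is only applied to increasing a.
difference : ∀ {n N} → (Fin n → Fin N) → Fin (pred n) → ℕ
difference {zero}  a ()
difference {suc n} a i = toℕ (a (suc i)) ∸ toℕ (a (inject₁ i))

{-# OPTIONS --safe #-}
module Submission where

open import Defs
open import Data.Empty using (⊥-elim)
open import Data.Fin.Base as Fin using (Fin; toℕ; fromℕ<; inject₁)
import Data.Fin.Properties as Fin
open import Data.Fin.Subset using (Subset; ∣_∣; ⁅_⁆; _∪_)
  renaming (_∈_ to _∈ₛ_; ⊥ to ∅; inside to inₛ; outside to outₛ)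
open import Data.Fin.Subset.Properties using (x∈⁅x⁆; x∈p∪q⁺; ∪-comm; ∪-identityˡ)
open import Data.List.Base using (List; []; _∷_; [_]; _++_; map; length; upTo; concat; concatMap; filter; allFin; cartesianProduct)
open import Data.List.Properties using (length-upTo; ≡-dec; length-++; length-map; length-filter; length-tabulate; ∷-injective; ∷-injectiveˡ; ∷-injectiveʳ; map-cong; map-cong-local)
open import Data.List.Membership.Propositional using (_∈_; _∉_; find; lose)
open import Data.List.Membership.Propositional.Properties
open import Data.List.Relation.Unary.All as All using (All; []; _∷_)
open import Data.List.Relation.Unary.All.Properties using (¬All⇒Any¬)
open import Data.List.Relation.Unary.AllPairs using (AllPairs; []; _∷_)
open import Data.List.Relation.Unary.Any using (here; there)
open import Data.List.Relation.Unary.Unique.Propositional using (Unique)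
import Data.List.Relation.Unary.Unique.Propositional.Properties as Unique
open import Data.Nat.Base
open import Data.Nat.Properties
open import Data.Nat.Tactic.RingSolver using (solve-∀)
open import Data.Product.Base using (∃; ∃₂; _×_; _,_; proj₁; proj₂)
open import Data.Product.Properties using () renaming (≡-dec to ×-≡-dec)
open import Data.Sum.Base using (_⊎_; inj₁; inj₂)
open import Data.Unit.Base using (⊤; tt)
open import Data.Vec.Base using () renaming ([] to []ᵥ; _∷_ to _∷ᵥ_)
open import Function.Base using (_∘_; id)
open import Function.Definitions using (Injective)
open import Level using (0ℓ)
open import Relation.Binary.Core using (Rel; _Preserves_⟶_)
open import Relation.Binary.Definitions using (DecidableEquality; tri<; tri≈; tri>)
open import Relation.Binary.PropositionalEquality hiding ([_])
open import Relation.Binary.Structures using (IsStrictTotalOrder)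
open import Relation.Nullary using (Dec; yes; no; ¬_; contradiction)
open import Relation.Nullary.Decidable using (_×-dec_; _→-dec_; ¬?; decidable-stable)

-- Write numbers in base 2m - 1, using digits below m only.  The difference of
-- two such numbers is then governed by the most significant digit in which they
-- differ, so it suffices to find, in the tree of digit strings, n leaves in
-- lexicographic order whose consecutive members part at distinct levels in the
-- prescribed order (the largest gap nearest to the root), all pairs of leaves
-- having one colour.  Let the branching at level k grow doubly exponentially,
-- and choose a child of every node at random; this selects a leaf below every
-- node.  With positive probability, no chosen child is distinguishable from all
-- its siblings by the colours it forms with a few other selected leaves (a
-- company) and by the future of the construction below it: a union bound over
-- the nodes and the companies works because a company is determined by one
-- direction per level above.  So every node y, relative to any assignment of
-- colours to the levels above it, has a sibling pair of indistinguishable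
-- children, and the colour of that pair is the only thing that can fail to suit
-- a chain of a given colour.  If each colour e failed because of some company
-- then these companies could be merged into a single one, since each level
-- serves one colour only, and the colour of the pair found for it would not
-- fail.  Hence a colour can be assigned to level after level, consistently for
-- all nodes involved, such that chains of that colour can be split there at any
-- of their members.  With n c levels, some colour occurs n times.

private variable
  A B : Set

-- Finite sums

sumOf : List A → (A → ℕ) → ℕ
sumOf []       g = 0
sumOf (x ∷ xs) g = g x + sumOf xs g

sumOf-cong : {g h : A → ℕ} → (∀ x → g x ≡ h x) → ∀ xs → sumOf xs g ≡ sumOf xs h
sumOf-cong g≗h []       = refl
sumOf-cong g≗h (x ∷ xs) = cong₂ _+_ (g≗h x) (sumOf-cong g≗h xs)

sumOf-mono : {g h : A → ℕ} → ∀ xs → (∀ {x} → x ∈ xs → g x ≤ h x) → sumOf xs g ≤ sumOf xs h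
sumOf-mono []       g≤h = z≤n
sumOf-mono (x ∷ xs) g≤h = +-mono-≤ (g≤h (here refl)) (sumOf-mono xs (g≤h ∘ there))

sumOf-const : ∀ k (xs : List A) → sumOf xs (λ _ → k) ≡ length xs * k
sumOf-const k []       = refl
sumOf-const k (x ∷ xs) = cong (k +_) (sumOf-const k xs)

sumOf-≤ : ∀ {g : A → ℕ} {k} xs → (∀ {x} → x ∈ xs → g x ≤ k) → sumOf xs g ≤ length xs * k
sumOf-≤ {k = k} xs g≤k = ≤-trans (sumOf-mono xs g≤k) (≤-reflexive (sumOf-const k xs))

sumOf-* : ∀ k (g : A → ℕ) xs → k * sumOf xs g ≡ sumOf xs (λ x → k * g x)
sumOf-* k g []       = *-zeroʳ k
sumOf-* k g (x ∷ xs) = trans (*-distribˡ-+ k (g x) (sumOf xs g)) (cong (k * g x +_) (sumOf-* k g xs))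

sumOf-+ : ∀ (g h : A → ℕ) xs → sumOf xs (λ x → g x + h x) ≡ sumOf xs g + sumOf xs h
sumOf-+ g h []       = refl
sumOf-+ g h (x ∷ xs) rewrite sumOf-+ g h xs = begin
  g x + h x + (G + H)   ≡⟨ +-assoc (g x) (h x) (G + H) ⟩
  g x + (h x + (G + H)) ≡⟨ cong (g x +_) (x+[y+z]≡y+[x+z] (h x) G H) ⟩
  g x + (G + (h x + H)) ≡⟨ +-assoc (g x) G (h x + H) ⟨
  g x + G + (h x + H)   ∎
  where
  open ≡-Reasoning
  G H : ℕ
  G = sumOf xs g
  H = sumOf xs h
  x+[y+z]≡y+[x+z] : ∀ a b c → a + (b + c) ≡ b + (a + c)
  x+[y+z]≡y+[x+z] a b c = trans (sym (+-assoc a b c)) (trans (cong (_+ c) (+-comm a b)) (+-assoc b a c))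

sumOf-swap : ∀ (g : A → B → ℕ) xs ys →
  sumOf xs (λ x → sumOf ys (g x)) ≡ sumOf ys (λ y → sumOf xs (λ x → g x y))
sumOf-swap g []       ys = sym (trans (sumOf-const 0 ys) (*-zeroʳ (length ys)))
sumOf-swap g (x ∷ xs) ys = trans (cong (sumOf ys (g x) +_) (sumOf-swap g xs ys))
  (sym (sumOf-+ (g x) (λ y → sumOf xs (λ x′ → g x′ y)) ys))

sumOf≡0 : ∀ {g : A → ℕ} {xs x} → sumOf xs g ≡ 0 → x ∈ xs → g x ≡ 0
sumOf≡0 {g = g} {x ∷ xs} eq (here refl) = m+n≡0⇒m≡0 (g x) eq
sumOf≡0 {g = g} {x ∷ xs} eq (there x∈)  = sumOf≡0 (m+n≡0⇒n≡0 (g x) eq) x∈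

sumOf-<-∃ : ∀ {g : A → ℕ} {k} xs → sumOf xs g < length xs * k → ∃ λ x → x ∈ xs × g x < k
sumOf-<-∃ {g = g} {k} (x ∷ xs) lt with g x <? k
... | yes gx<k = x , here refl , gx<k
... | no  gx≮k with sumOf-<-∃ xs (+-cancelˡ-< k _ _ (≤-<-trans (+-monoˡ-≤ _ (≮⇒≥ gx≮k)) lt))
...   | y , y∈ , gy<k = y , there y∈ , gy<k

length-concatMap-≤ : ∀ {k} (g : A → List B) xs →
  (∀ {x} → x ∈ xs → length (g x) ≤ k) → length (concatMap g xs) ≤ length xs * k
length-concatMap-≤ g []       g≤ = z≤n
length-concatMap-≤ g (x ∷ xs) g≤ rewrite length-++ (g x) {concatMap g xs} =
  +-mono-≤ (g≤ (here refl)) (length-concatMap-≤ g xs (g≤ ∘ there))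

⟦_⟧ : {P : Set} → Dec P → ℕ
⟦ yes _ ⟧ = 1
⟦ no  _ ⟧ = 0

⟦⟧≡0 : {P : Set} {P? : Dec P} → ⟦ P? ⟧ ≡ 0 → ¬ P
⟦⟧≡0 {P? = no ¬p} eq = ¬p

⟦⟧-cong : {P Q : Set} {P? : Dec P} {Q? : Dec Q} → (P → Q) → (Q → P) → ⟦ P? ⟧ ≡ ⟦ Q? ⟧
⟦⟧-cong {P? = yes p} {yes q} P→Q Q→P = refl
⟦⟧-cong {P? = yes p} {no ¬q} P→Q Q→P = ⊥-elim (¬q (P→Q p))
⟦⟧-cong {P? = no ¬p} {yes q} P→Q Q→P = ⊥-elim (¬p (Q→P q))
⟦⟧-cong {P? = no ¬p} {no ¬q} P→Q Q→P = refl

-- Nodes of a tree are the sequences of the directions leading to them,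
-- the last direction first.
Node : Set
Node = List ℕ

-- Choice functions, one chosen direction at every node, and their updates

Rep : Set
Rep = Node → ℕ

_≟ᴺ_ : (u v : Node) → Dec (u ≡ v)
_≟ᴺ_ = ≡-dec _≟_

open import Data.List.Membership.DecPropositional _≟ᴺ_ using (_∈?_)

_[_≔_] : Rep → Node → ℕ → Rep
(ρ [ y ≔ v ]) u with u ≟ᴺ y
... | yes _ = v
... | no  _ = ρ u

≔-this : ∀ ρ y v → (ρ [ y ≔ v ]) y ≡ v
≔-this ρ y v with y ≟ᴺ y
... | yes _   = refl
... | no y≢y = ⊥-elim (y≢y refl)

≔-other : ∀ ρ {y u} v → u ≢ y → (ρ [ y ≔ v ]) u ≡ ρ u
≔-other ρ {y} {u} v u≢y with u ≟ᴺ y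
... | yes u≡y = ⊥-elim (u≢y u≡y)
... | no  _   = refl

≔-cong : ∀ {ρ σ} y v → ρ ≗ σ → (ρ [ y ≔ v ]) ≗ (σ [ y ≔ v ])
≔-cong y v ρ≗σ u with u ≟ᴺ y
... | yes _ = refl
... | no  _ = ρ≗σ u

≔-comm : ∀ ρ {y z} v w → y ≢ z → (ρ [ y ≔ v ] [ z ≔ w ]) ≗ (ρ [ z ≔ w ] [ y ≔ v ])
≔-comm ρ {y} {z} v w y≢z u with u ≟ᴺ z | u ≟ᴺ y
... | yes refl | yes refl = ⊥-elim (y≢z refl)
... | yes refl | no _ with u ≟ᴺ u
...   | yes _   = refl
...   | no u≢u = ⊥-elim (u≢u refl)
≔-comm ρ {y} {z} v w y≢z u | no u≢z | yes refl with u ≟ᴺ u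
... | yes _   = refl
... | no u≢u = ⊥-elim (u≢u refl)
≔-comm ρ {y} {z} v w y≢z u | no u≢z | no u≢y with u ≟ᴺ y | u ≟ᴺ z
... | yes u≡y | _       = ⊥-elim (u≢y u≡y)
... | no _    | yes u≡z = ⊥-elim (u≢z u≡z)
... | no _    | no _    = refl

-- Updates at different nodes commute only pointwise (`≔-comm`), so a quantity averaged over choice
-- functions has to respect `≗`.
Extensional : (Rep → ℕ) → Set
Extensional g = ∀ {ρ σ} → ρ ≗ σ → g ρ ≡ g σ

-- Counting the ways to redefine a choice function on a list of nodes

module Reassign (size : Node → ℕ) where

  -- This is `card Y` times the expectation of `g` under independent uniform choices at the nodes of
  -- `Y`. If a node is listed twice, the later update overwrites the earlier one, which leaves the
  -- expectation unchanged.
  total : List Node → (Rep → ℕ) → Rep → ℕ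
  total []      g ρ = g ρ
  total (y ∷ Y) g ρ = sumOf (upTo (size y)) λ v → total Y g (ρ [ y ≔ v ])

  card : List Node → ℕ
  card []      = 1
  card (y ∷ Y) = size y * card Y

  Valid : Rep → Set
  Valid ρ = ∀ u → ρ u < size u

  total-extensional : ∀ Y {g} → Extensional g → Extensional (total Y g)
  total-extensional []      g-ext ρ≗σ = g-ext ρ≗σ
  total-extensional (y ∷ Y) g-ext ρ≗σ =
    sumOf-cong (λ v → total-extensional Y g-ext (≔-cong y v ρ≗σ)) (upTo (size y))

  slice : Node → (Rep → ℕ) → Rep → ℕ
  slice y g ρ = sumOf (upTo (size y)) λ v → g (ρ [ y ≔ v ])

  total-slice : ∀ Y {g y} ρ → Extensional g → y ∉ Y → slice y (total Y g) ρ ≡ total Y (slice y g) ρ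
  total-slice []      ρ g-ext y∉ = refl
  total-slice (z ∷ Y) {g} {y} ρ g-ext y∉ = begin
    sumOf Vy (λ v → sumOf Vz (λ w → total Y g (ρ [ y ≔ v ] [ z ≔ w ])))
      ≡⟨ sumOf-cong (λ v → sumOf-cong (λ w →
           total-extensional Y g-ext (≔-comm ρ v w (y∉ ∘ here))) Vz) Vy ⟩
    sumOf Vy (λ v → sumOf Vz (λ w → total Y g (ρ [ z ≔ w ] [ y ≔ v ])))
      ≡⟨ sumOf-swap _ Vy Vz ⟩
    sumOf Vz (λ w → slice y (total Y g) (ρ [ z ≔ w ]))
      ≡⟨ sumOf-cong (λ w → total-slice Y (ρ [ z ≔ w ]) g-ext (y∉ ∘ there)) Vz ⟩
    sumOf Vz (λ w → total Y (slice y g) (ρ [ z ≔ w ])) ∎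
    where
    open ≡-Reasoning
    Vy Vz : List ℕ
    Vy = upTo (size y)
    Vz = upTo (size z)

  sumOf-upTo-≤ : ∀ k {g b} → (∀ v → g v ≤ b) → sumOf (upTo k) g ≤ k * b
  sumOf-upTo-≤ k {g} {b} g≤b = begin
    sumOf (upTo k) g    ≤⟨ sumOf-≤ (upTo k) (λ _ → g≤b _) ⟩
    length (upTo k) * b ≡⟨ cong (_* b) (length-upTo k) ⟩
    k * b               ∎
    where open ≤-Reasoning

  total-≤ : ∀ Y {g b} ρ → (∀ σ → g σ ≤ b) → total Y g ρ ≤ b * card Y
  total-≤ []      {g} {b} ρ g≤b = ≤-trans (g≤b ρ) (≤-reflexive (sym (*-identityʳ b)))
  total-≤ (y ∷ Y) {g} {b} ρ g≤b = begin
    total (y ∷ Y) g ρ   ≤⟨ sumOf-upTo-≤ (size y) (λ v → total-≤ Y (ρ [ y ≔ v ]) g≤b) ⟩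
    size y * (b * card Y) ≡⟨ *-assoc (size y) b (card Y) ⟨
    size y * b * card Y ≡⟨ cong (_* card Y) (*-comm (size y) b) ⟩
    b * size y * card Y ≡⟨ *-assoc b (size y) (card Y) ⟩
    b * card (y ∷ Y)    ∎
    where open ≤-Reasoning

  -- Averaging over the choice at `y` alone already gives at most `b / size y`, whatever the other
  -- choices are. The sum over that choice is moved innermost, starting from the last occurrence of
  -- `y` in the list.
  total-slice-≤ : ∀ Y {g b y} ρ → Extensional g → y ∈ Y → (∀ σ → slice y g σ ≤ b) →
    size y * total Y g ρ ≤ b * card Y
  total-slice-≤ (z ∷ Y) {g} {b} {y} ρ g-ext y∈ g≤b with y ∈? Y
  ... | yes y∈Y = begin
    size y * total (z ∷ Y) g ρ
      ≡⟨ sumOf-* (size y) _ (upTo (size z)) ⟩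
    sumOf (upTo (size z)) (λ v → size y * total Y g (ρ [ z ≔ v ]))
      ≤⟨ sumOf-upTo-≤ (size z) (λ v → total-slice-≤ Y (ρ [ z ≔ v ]) g-ext y∈Y g≤b) ⟩
    size z * (b * card Y)  ≡⟨ *-assoc (size z) b (card Y) ⟨
    size z * b * card Y    ≡⟨ cong (_* card Y) (*-comm (size z) b) ⟩
    b * size z * card Y    ≡⟨ *-assoc b (size z) (card Y) ⟩
    b * card (z ∷ Y)       ∎
    where open ≤-Reasoning
  ... | no y∉Y with y∈
  ...   | there y∈Y = contradiction y∈Y y∉Y
  ...   | here refl = begin
    size y * slice y (total Y g) ρ  ≡⟨ cong (size y *_) (total-slice Y ρ g-ext y∉Y) ⟩
    size y * total Y (slice y g) ρ  ≤⟨ *-monoʳ-≤ (size y) (total-≤ Y ρ g≤b) ⟩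
    size y * (b * card Y)           ≡⟨ *-assoc (size y) b (card Y) ⟨
    size y * b * card Y             ≡⟨ cong (_* card Y) (*-comm (size y) b) ⟩
    b * size y * card Y             ≡⟨ *-assoc b (size y) (card Y) ⟩
    b * card (y ∷ Y)                ∎
    where open ≤-Reasoning

  total-sumOf : ∀ Y (g : A → Rep → ℕ) xs ρ →
    total Y (λ σ → sumOf xs (λ x → g x σ)) ρ ≡ sumOf xs (λ x → total Y (g x) ρ)
  total-sumOf []      g xs ρ = refl
  total-sumOf (y ∷ Y) g xs ρ = trans
    (sumOf-cong (λ v → total-sumOf Y g xs (ρ [ y ≔ v ])) (upTo (size y)))
    (sumOf-swap _ (upTo (size y)) xs)

  -- First-moment method: fix the choices one node at a time, keeping the conditional average below
  -- 1; at the end the natural number `g σ` is itself below 1.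
  total-<-∃ : ∀ Y {g} ρ → Valid ρ → total Y g ρ < card Y → ∃ λ σ → Valid σ × g σ ≡ 0
  total-<-∃ []      ρ valid lt = ρ , valid , n<1⇒n≡0 lt
  total-<-∃ (y ∷ Y) {g} ρ valid lt
    with sumOf-<-∃ (upTo (size y)) (subst (λ k → sumOf (upTo (size y)) (λ v → total Y g (ρ [ y ≔ v ])) < k * card Y)
           (sym (length-upTo (size y))) lt)
  ... | v , v∈ , lt′ = total-<-∃ Y (ρ [ y ≔ v ]) valid′ lt′
    where
    valid′ : Valid (ρ [ y ≔ v ])
    valid′ u with u ≟ᴺ y
    ... | yes refl = ∈-upTo⁻ v∈
    ... | no  _    = valid u

-- Words over an alphabet and a pigeonhole count

words : ℕ → List A → List (List A)
words zero    xs = [ [] ]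
words (suc k) xs = concatMap (λ w → map (_∷ w) xs) (words k xs)

length-words : ∀ k (xs : List A) → length (words k xs) ≤ length xs ^ k
length-words zero    xs = ≤-refl
length-words (suc k) xs = begin
  length (words (suc k) xs)      ≤⟨ length-concatMap-≤ _ (words k xs) (λ {w} _ → ≤-reflexive (length-map (_∷ w) xs)) ⟩
  length (words k xs) * length xs ≤⟨ *-monoˡ-≤ (length xs) (length-words k xs) ⟩
  length xs ^ k * length xs       ≡⟨ *-comm (length xs ^ k) (length xs) ⟩
  length xs ^ suc k               ∎
  where open ≤-Reasoning

∈-words : ∀ {xs : List A} w → (∀ {x} → x ∈ w → x ∈ xs) → w ∈ words (length w) xs
∈-words []      ⊆xs = here refl
∈-words (x ∷ w) ⊆xs = ∈-concatMap⁺ _ (lose (∈-words w (⊆xs ∘ there)) (∈-map⁺ (_∷ w) (⊆xs (here refl))))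

map-≡⇒≡ : ∀ {f g : A → B} {xs x} → map f xs ≡ map g xs → x ∈ xs → f x ≡ g x
map-≡⇒≡ {xs = _ ∷ _} eq (here refl) = ∷-injectiveˡ eq
map-≡⇒≡ {xs = _ ∷ _} eq (there x∈)  = map-≡⇒≡ (∷-injectiveʳ eq) x∈

≤-sumOf : ∀ (g : A → ℕ) {xs x} → x ∈ xs → g x ≤ sumOf xs g
≤-sumOf g (here refl) = m≤m+n _ _
≤-sumOf g (there x∈)  = m≤n⇒m≤o+n _ (≤-sumOf g x∈)

sumOf-zero : ∀ {g : A → ℕ} xs → (∀ {x} → x ∈ xs → g x ≡ 0) → sumOf xs g ≡ 0
sumOf-zero []       g≡0 = refl
sumOf-zero (x ∷ xs) g≡0 = cong₂ _+_ (g≡0 (here refl)) (sumOf-zero xs (g≡0 ∘ there))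

sum-subsingleton : ∀ {Q : A → Set} (Q? : ∀ v → Dec (Q v)) {xs} → Unique xs →
  (∀ {v w} → v ∈ xs → w ∈ xs → Q v → Q w → v ≡ w) → sumOf xs (λ v → ⟦ Q? v ⟧) ≤ 1
sum-subsingleton Q? {[]}     _           _    = z≤n
sum-subsingleton Q? {x ∷ xs} (x∉ ∷ uniq) same with Q? x
... | no  _  = sum-subsingleton Q? uniq (λ v∈ w∈ → same (there v∈) (there w∈))
... | yes Qx = s≤s (≤-reflexive (sumOf-zero xs zero′))
  where
  zero′ : ∀ {v} → v ∈ xs → ⟦ Q? v ⟧ ≡ 0
  zero′ {v} v∈ with Q? v
  ... | no  _  = refl
  ... | yes Qv = ⊥-elim (All.lookup x∉ v∈ (same (here refl) (there v∈) Qx Qv))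

module _ {P : Set} (_≟ᴾ_ : DecidableEquality P) where

  Repeated : (ℕ → P) → ℕ → ℕ → Set
  Repeated p k v = ∃ λ w → w < k × (w ≢ v × p w ≡ p v)

  repeated? : ∀ p k v → Dec (Repeated p k v)
  repeated? p k v = anyUpTo? (λ w → ¬? (w ≟ v) ×-dec (p w ≟ᴾ p v)) k

  -- Two unrepeated arguments cannot share a value, so each entry of `ps` accounts for at most one
  -- of them.
  count-unrepeated : ∀ p k ps → (∀ v → p v ∈ ps) →
    sumOf (upTo k) (λ v → ⟦ ¬? (repeated? p k v) ⟧) ≤ length ps
  count-unrepeated p k ps p∈ = begin
    sumOf (upTo k) (λ v → ⟦ ¬? (repeated? p k v) ⟧)
      ≤⟨ sumOf-mono (upTo k) (λ {v} _ → by-value v) ⟩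
    sumOf (upTo k) (λ v → sumOf ps (λ q → ⟦ Q? q v ⟧))
      ≡⟨ sumOf-swap (λ v q → ⟦ Q? q v ⟧) (upTo k) ps ⟩
    sumOf ps (λ q → sumOf (upTo k) (λ v → ⟦ Q? q v ⟧))
      ≤⟨ sumOf-≤ ps (λ {q} _ → sum-subsingleton (Q? q) (Unique.upTo⁺ k) Q-unique) ⟩
    length ps * 1 ≡⟨ *-identityʳ (length ps) ⟩
    length ps ∎
    where
    open ≤-Reasoning
    Q : P → ℕ → Set
    Q q v = ¬ Repeated p k v × p v ≡ q
    Q? : ∀ q v → Dec (Q q v)
    Q? q v = ¬? (repeated? p k v) ×-dec (p v ≟ᴾ q)
    by-value : ∀ v → ⟦ ¬? (repeated? p k v) ⟧ ≤ sumOf ps (λ q → ⟦ Q? q v ⟧)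
    by-value v = ≤-trans
      (≤-reflexive (⟦⟧-cong {Q? = Q? (p v) v} (λ ¬r → ¬r , refl) proj₁))
      (≤-sumOf (λ q → ⟦ Q? q v ⟧) (p∈ v))
    Q-unique : ∀ {q v w} → v ∈ upTo k → w ∈ upTo k → Q q v → Q q w → v ≡ w
    Q-unique {q} {v} {w} v∈ w∈ (¬r , pv≡q) (_ , pw≡q) with v ≟ w
    ... | yes v≡w = v≡w
    ... | no  v≢w = ⊥-elim (¬r (w , ∈-upTo⁻ w∈ , v≢w ∘ sym , trans pw≡q (sym pv≡q)))

-- Cardinalities entering the union bound

module Bounds (c : ℕ) (size : ℕ → ℕ) where

  -- A company at level `k` has at most `k` members. In the step down either nobody joins, or one of
  -- the `size k` children of one of at most `1 + k` parents does.
  companyBound : ℕ → ℕ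
  companyBound zero    = 1
  companyBound (suc k) = companyBound k * (1 + (1 + k) * size k)

  width : ℕ → ℕ
  width zero    = 1
  width (suc k) = width k * size k

  -- The first factor counts colours towards at most `k` companions, the second one schedule of
  -- length `h` for each of the `c` colours that the level might receive.
  profileBound : ℕ → ℕ → ℕ
  profileBound k h = c ^ k * (c ^ h) ^ c

  -- The factors count histories, companies and profiles.
  levelBound : ℕ → ℕ → ℕ
  levelBound k h = c ^ k * (companyBound k * profileBound k h)

-- Companies and schedules

-- The nodes of level k have size k children.  Only the values of F on leaves
-- matter: a node u at height h is represented by the leaf follow ρ h u.

module Tree (c : ℕ) (c₀ : Fin c) (size : ℕ → ℕ) (F : Node → Node → Fin c) where

  open Bounds c size

  private variable
    ρ σ : Rep
    y y′ u w v z : Node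
    e g : Fin c
    h d k : ℕ

  Colour : Set
  Colour = Fin c

  History : Set
  History = List Colour

  colours : List Colour
  colours = allFin c

  -- The default `c₀` makes `schedule` definable before it is known that some colour is good.
  pickFrom : {P : Colour → Set} → (∀ e → Dec (P e)) → List Colour → Colour
  pickFrom P? []       = c₀
  pickFrom P? (e ∷ es) with P? e
  ... | yes _ = e
  ... | no  _ = pickFrom P? es

  pick : {P : Colour → Set} → (∀ e → Dec (P e)) → Colour
  pick P? = pickFrom P? colours

  pick-sound : ∀ {P : Colour → Set} (P? : ∀ e → Dec (P e)) → P e → P (pick P?)
  pick-sound {P = P} P? Pe = go (∈-allFin _) Pe
    where
    go : ∀ {e es} → e ∈ es → P e → P (pickFrom P? es)
    go {es = e′ ∷ es} e∈ Pe with P? e′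
    ... | yes Pe′ = Pe′
    go (here refl) Pe | no ¬P = ⊥-elim (¬P Pe)
    go (there e∈)  Pe | no ¬P = go e∈ Pe

  pick-cong : ∀ {P Q : Colour → Set} (P? : ∀ e → Dec (P e)) (Q? : ∀ e → Dec (Q e)) →
    (∀ e → P e → Q e) → (∀ e → Q e → P e) → pick P? ≡ pick Q?
  pick-cong P? Q? P→Q Q→P = go colours
    where
    go : ∀ es → pickFrom P? es ≡ pickFrom Q? es
    go []       = refl
    go (e ∷ es) with P? e | Q? e
    ... | yes p | yes q = refl
    ... | yes p | no ¬q = ⊥-elim (¬q (P→Q e p))
    ... | no ¬p | yes q = ⊥-elim (¬p (Q→P e q))
    ... | no ¬p | no ¬q = go es

  follow : Rep → ℕ → Node → Node
  follow ρ zero    u = u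
  follow ρ (suc h) u = follow ρ h (ρ u ∷ u)

  -- A company of a node y, relative to the colours x of the levels above y
  -- (nearest level first), lists nodes of the level of y that may coexist with
  -- y in the chains under construction: a node coloured g belongs to a chain
  -- of colour g.  Going down one level, its members move to their chosen
  -- children, and at most one newcomer branches off from y or from a member.
  Company : Set
  Company = List (Colour × Node)

  advance : Rep → Company → Company
  advance ρ = map λ p → proj₁ p , ρ (proj₂ p) ∷ proj₂ p

  parents : Colour → Node → Company → List Node
  parents g y U = y ∷ map proj₂ (filter (λ p → proj₁ p Fin.≟ g) U)

  newcomers : Colour → ℕ → Node → Company → List Node
  newcomers g d y U = filter (λ v → ¬? (v ≟ᴺ (d ∷ y)))
    (concatMap (λ w → map (_∷ w) (upTo (size (length y)))) (parents g y U))

  grow : Rep → Colour → ℕ → Node → Company → List Company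
  grow ρ g d y U = advance ρ U ∷ map (λ v → (g , v) ∷ advance ρ U) (newcomers g d y U)

  companies : Rep → History → Node → List Company
  companies ρ []      []      = [ [] ]
  companies ρ (g ∷ x) (d ∷ y) = concatMap (grow ρ g d y) (companies ρ x y)
  -- A history whose length is not that of the node admits no company.
  companies ρ _       _       = []

  -- The relational form of `grow`; matching on it exposes the parent of the newcomer.
  data Grow (ρ : Rep) (g : Colour) (d : ℕ) (y : Node) (U : Company) : Company → Set where
    stay : Grow ρ g d y U (advance ρ U)
    join : ∀ {a w} → a < size (length y) → w ≡ y ⊎ (g , w) ∈ U → a ∷ w ≢ d ∷ y →
           Grow ρ g d y U ((g , a ∷ w) ∷ advance ρ U)

  ∈-parents⁺ : ∀ {U} → w ≡ y ⊎ (g , w) ∈ U → w ∈ parents g y U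
  ∈-parents⁺ (inj₁ refl) = here refl
  ∈-parents⁺ {g = g} (inj₂ gw∈) = there (∈-map⁺ proj₂ (∈-filter⁺ (λ p → proj₁ p Fin.≟ g) gw∈ refl))

  ∈-parents⁻ : ∀ {U} → w ∈ parents g y U → w ≡ y ⊎ (g , w) ∈ U
  ∈-parents⁻ (here eq) = inj₁ eq
  ∈-parents⁻ {g = g} {U = U} (there w∈) with ∈-map⁻ proj₂ w∈
  ... | p , p∈ , refl with ∈-filter⁻ (λ p → proj₁ p Fin.≟ g) {xs = U} p∈
  ...   | p∈U , refl = inj₂ p∈U

  grow⁺ : ∀ {U V} → Grow ρ g d y U V → V ∈ grow ρ g d y U
  grow⁺ stay = here refl
  grow⁺ {g = g} {d} {y} {U} (join a< w∈ ≢) = there (∈-map⁺ _ (∈-filter⁺ (λ v → ¬? (v ≟ᴺ (d ∷ y)))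
    (∈-concatMap⁺ (λ w → map (_∷ w) (upTo (size (length y))))
      (lose (∈-parents⁺ w∈) (∈-map⁺ _ (∈-upTo⁺ a<)))) ≢))

  grow⁻ : ∀ {U V} → V ∈ grow ρ g d y U → Grow ρ g d y U V
  grow⁻ (here refl) = stay
  grow⁻ {g = g} {d} {y} {U} (there V∈) with ∈-map⁻ _ V∈
  ... | v , v∈ , refl with ∈-filter⁻ (λ v → ¬? (v ≟ᴺ (d ∷ y))) v∈
  ...   | v∈′ , v≢ with find (∈-concatMap⁻ (λ w → map (_∷ w) (upTo (size (length y)))) {parents g y U} v∈′)
  ...     | w , w∈ , v∈″ with ∈-map⁻ (_∷ w) v∈″
  ...       | a , a∈ , refl = join (∈-upTo⁻ a∈) (∈-parents⁻ {U = U} w∈) v≢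

  companies⁺ : ∀ {x U V} → U ∈ companies ρ x y → Grow ρ g d y U V → V ∈ companies ρ (g ∷ x) (d ∷ y)
  companies⁺ {ρ = ρ} {y} {g} {d} U∈ gr = ∈-concatMap⁺ (grow ρ g d y) (lose U∈ (grow⁺ gr))

  companies⁻ : ∀ {x V} → V ∈ companies ρ (g ∷ x) (d ∷ y) →
    ∃ λ U → U ∈ companies ρ x y × Grow ρ g d y U V
  companies⁻ {ρ} {g} {d} {y} {x} V∈ with find (∈-concatMap⁻ (grow ρ g d y) {companies ρ x y} V∈)
  ... | U , U∈ , V∈′ = U , U∈ , grow⁻ V∈′

  -- Newcomers avoid the node by definition, and descendants of earlier members have a parent other
  -- than that of the node. Hence following a member down never consults the choice at `y` itself.
  company-node : ∀ ρ x y {U} → U ∈ companies ρ x y → (g , u) ∈ U → length u ≡ length y × u ≢ y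
  company-node ρ []      []      (here refl) ()
  company-node ρ (_ ∷ x) (d ∷ y) V∈ u∈ with companies⁻ {x = x} V∈
  company-node ρ (_ ∷ x) (d ∷ y) V∈ u∈ | U , U∈ , stay with ∈-map⁻ _ u∈
  ... | p , p∈ , refl with company-node ρ x y U∈ p∈
  ...   | len , u≢ = cong suc len , u≢ ∘ ∷-injectiveʳ
  company-node ρ (_ ∷ x) (d ∷ y) V∈ (here refl) | U , U∈ , join a< (inj₁ refl) ≢ = refl , ≢
  company-node ρ (_ ∷ x) (d ∷ y) V∈ (here refl) | U , U∈ , join a< (inj₂ w∈) ≢
    with company-node ρ x y U∈ w∈
  ... | len , _ = cong suc len , ≢
  company-node ρ (_ ∷ x) (d ∷ y) V∈ (there u∈) | U , U∈ , join a< w∈ ≢ with ∈-map⁻ _ u∈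
  ... | p , p∈ , refl with company-node ρ x y U∈ p∈
  ...   | len , u≢ = cong suc len , u≢ ∘ ∷-injectiveʳ

  company-size : ∀ ρ x y {U} → U ∈ companies ρ x y → length U ≤ length y
  company-size ρ []      []      (here refl) = z≤n
  company-size ρ (_ ∷ x) (d ∷ y) V∈ with companies⁻ {x = x} V∈
  ... | U , U∈ , stay       = ≤-trans (≤-reflexive (length-map _ U)) (m≤n⇒m≤1+n (company-size ρ x y U∈))
  ... | U , U∈ , join _ _ _ = s≤s (≤-trans (≤-reflexive (length-map _ U)) (company-size ρ x y U∈))

  length-companies : ∀ ρ x y → length (companies ρ x y) ≤ companyBound (length y)
  length-companies ρ []      []      = ≤-refl
  length-companies ρ []      (d ∷ y) = z≤n
  length-companies ρ (g ∷ x) []      = z≤n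
  length-companies ρ (g ∷ x) (d ∷ y) = ≤-trans
    (length-concatMap-≤ (grow ρ g d y) (companies ρ x y) each)
    (*-monoˡ-≤ _ (length-companies ρ x y))
    where
    open ≤-Reasoning
    K : ℕ
    K = size (length y)
    children : Node → List Node
    children w = map (_∷ w) (upTo K)
    each : ∀ {U} → U ∈ companies ρ x y → length (grow ρ g d y U) ≤ 1 + (1 + length y) * K
    each {U} U∈ = s≤s (begin
      length (map _ (newcomers g d y U))     ≡⟨ length-map _ (newcomers g d y U) ⟩
      length (newcomers g d y U)             ≤⟨ length-filter _ (concatMap children (parents g y U)) ⟩
      length (concatMap children (parents g y U))
        ≤⟨ length-concatMap-≤ children (parents g y U)
             (λ {w} _ → ≤-reflexive (trans (length-map (_∷ w) (upTo K)) (length-upTo K))) ⟩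
      length (parents g y U) * K
        ≡⟨ cong (λ l → suc l * K) (length-map proj₂ (filter _ U)) ⟩
      (1 + length (filter _ U)) * K
        ≤⟨ *-monoˡ-≤ K (s≤s (≤-trans (length-filter _ U) (company-size ρ x y U∈))) ⟩
      (1 + length y) * K                     ∎)

  Joined : Rep → ℕ → Colour → Node → Company → Set
  Joined ρ h e v U = All (λ p → proj₁ p ≡ e → F v (follow ρ (suc h) (proj₂ p)) ≡ e) U

  joined? : ∀ ρ h e v U → Dec (Joined ρ h e v U)
  joined? ρ h e v = All.all? λ p → (proj₁ p Fin.≟ e) →-dec (F v (follow ρ (suc h) (proj₂ p)) Fin.≟ e)

  -- The child z of y can be added next to ρ y to a chain of colour e.
  Twin : Rep → ℕ → Node → Colour → (ℕ → History) → Company → ℕ → Set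
  Twin ρ h y e θ U z =
    F (follow ρ h (z ∷ y)) (follow ρ (suc h) y) ≡ e ×
    Joined ρ h e (follow ρ h (z ∷ y)) U ×
    (z ≢ ρ y × θ z ≡ θ (ρ y))

  -- A twin is demanded only next to companies that the chosen leaf already fits. The futures `θ`
  -- are a parameter because `schedule`, which supplies them, is itself defined through `Good`.
  Good : Rep → ℕ → History → Node → (Colour → ℕ → History) → Colour → Set
  Good ρ h x y θ e = All (λ U → Joined ρ h e (follow ρ (suc h) y) U →
    ∃ λ z → z < size (length y) × Twin ρ h y e (θ e) U z) (companies ρ x y)

  _≟ᴴ_ : DecidableEquality History
  _≟ᴴ_ = ≡-dec Fin._≟_

  good? : ∀ ρ h x y θ e → Dec (Good ρ h x y θ e)
  good? ρ h x y θ e = All.all? (λ U → joined? ρ h e (follow ρ (suc h) y) U →-dec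
    anyUpTo? (λ z → (F (follow ρ h (z ∷ y)) (follow ρ (suc h) y) Fin.≟ e) ×-dec
      (joined? ρ h e (follow ρ h (z ∷ y)) U ×-dec
        (¬? (z ≟ ρ y) ×-dec (θ e z ≟ᴴ θ e (ρ y))))) (size (length y))) (companies ρ x y)

  -- The colours that the levels below y receive once the levels above y have
  -- received the colours x.
  schedule : Rep → ℕ → History → Node → History
  schedule ρ zero    x y = []
  schedule ρ (suc h) x y =
    let e₁ = pick (good? ρ h x y (λ e z → schedule ρ h (e ∷ x) (z ∷ y))) in
    e₁ ∷ schedule ρ h (e₁ ∷ x) (ρ y ∷ y)

  -- What depends on the choices made off a given node

  OffEqual : Node → Rep → Rep → Set
  OffEqual y ρ σ = ∀ u → u ≢ y → ρ u ≡ σ u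

  data _Extends_ : Node → Node → Set where
    self  : y Extends y
    child : y′ Extends y → (d ∷ y′) Extends y

  extends-≤ : y′ Extends y → length y ≤ length y′
  extends-≤ self       = ≤-refl
  extends-≤ (child ex) = m≤n⇒m≤1+n (extends-≤ ex)

  longer≢ : length y < length u → u ≢ y
  longer≢ lt refl = <-irrefl refl lt

  off-path : length y′ < length y ⊎ y′ Extends y → length u ≡ length y′ → u ≢ y′ → u ≢ y
  off-path (inj₁ lt)         len u≢ refl = <-irrefl (sym len) lt
  off-path (inj₂ self)       len u≢ u≡   = u≢ u≡
  off-path (inj₂ (child ex)) len u≢ refl = <-irrefl len (s≤s (extends-≤ ex))

  follow-off : OffEqual y ρ σ → ∀ h → length y < length u → follow ρ h u ≡ follow σ h u
  follow-off off zero    lt = refl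
  follow-off {ρ = ρ} {u = u} off (suc h) lt rewrite sym (off u (longer≢ lt)) =
    follow-off off h (m≤n⇒m≤1+n lt)

  follow-off′ : OffEqual y ρ σ → ∀ h → length u ≡ length y → u ≢ y →
    follow ρ (suc h) u ≡ follow σ (suc h) u
  follow-off′ {y} {ρ} {u = u} off h len u≢ rewrite sym (off u u≢) =
    follow-off off h (s≤s (≤-reflexive (sym len)))

  shrink : length (d ∷ y′) < length y ⊎ (d ∷ y′) Extends y → length y′ < length y ⊎ y′ Extends y
  shrink (inj₁ lt)         = inj₁ (<-trans (n<1+n _) lt)
  shrink (inj₂ self)       = inj₁ (n<1+n _)
  shrink (inj₂ (child ex)) = inj₂ ex

  -- A node `y′` shorter than `y` involves choices at shorter nodes only. For `y′` at or below `y`,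
  -- the members on the level of `y` are nodes other than `y`, by `company-node`.
  companies-off : OffEqual y ρ σ → ∀ x y′ → length y′ < length y ⊎ y′ Extends y →
    companies ρ x y′ ≡ companies σ x y′
  companies-off off []      []      on = refl
  companies-off off []      (d ∷ y) on = refl
  companies-off off (g ∷ x) []      on = refl
  companies-off {y} {ρ} {σ} off (g ∷ x) (d ∷ y′) on = trans
    (cong concat′ (map-cong-local (All.tabulate same)))
    (cong (concatMap (grow σ g d y′)) (companies-off off x y′ (shrink on)))
    where
    concat′ : List (List Company) → List Company
    concat′ = concat
    same : ∀ {U} → U ∈ companies ρ x y′ → grow ρ g d y′ U ≡ grow σ g d y′ U
    same {U} U∈ = cong (λ V → V ∷ map (λ v → (g , v) ∷ V) (newcomers g d y′ U))
      (map-cong-local (All.tabulate λ {p} p∈ →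
        let len , u≢ = company-node ρ x y′ U∈ p∈ in
        cong (λ a → proj₁ p , a ∷ proj₂ p) (off _ (off-path (shrink on) len u≢))))

  good-off : ∀ h x {θ ϑ} → OffEqual y ρ σ → length y < length y′ → y′ Extends y →
    (∀ z → θ e z ≡ ϑ e z) → Good ρ h x y′ θ e → Good σ h x y′ ϑ e
  good-off {y} {ρ} {σ} {y′} {e} h x {θ} {ϑ} off lt ex θ≗ϑ good =
    subst (All _) (companies-off off x y′ (inj₂ ex)) (All.tabulate step)
    where
    same-follow : ∀ h u → length y′ ≤ length u → follow ρ h u ≡ follow σ h u
    same-follow h u le = follow-off off h (<-≤-trans lt le)
    convert : ∀ {U v w} → U ∈ companies ρ x y′ → v ≡ w → Joined ρ h e v U → Joined σ h e w U
    convert U∈ refl j = All.tabulate λ {p} p∈ eq → subst (λ t → F _ t ≡ e)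
      (same-follow (suc h) _ (≤-reflexive (sym (proj₁ (company-node ρ x y′ U∈ p∈))))) (All.lookup j p∈ eq)
    revert : ∀ {U v w} → U ∈ companies ρ x y′ → v ≡ w → Joined σ h e v U → Joined ρ h e w U
    revert U∈ refl j = All.tabulate λ {p} p∈ eq → subst (λ t → F _ t ≡ e)
      (sym (same-follow (suc h) _ (≤-reflexive (sym (proj₁ (company-node ρ x y′ U∈ p∈)))))) (All.lookup j p∈ eq)
    ρy≡ : ρ y′ ≡ σ y′
    ρy≡ = off y′ (longer≢ lt)
    leaf≡ : follow ρ (suc h) y′ ≡ follow σ (suc h) y′
    leaf≡ = same-follow (suc h) y′ ≤-refl
    step : ∀ {U} → U ∈ companies ρ x y′ → Joined σ h e (follow σ (suc h) y′) U →
      ∃ λ z → z < size (length y′) × Twin σ h y′ e (ϑ e) U z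
    step U∈ j with All.lookup good U∈ (revert U∈ (sym leaf≡) j)
    ... | z , z< , col , j′ , z≢ , θ≡ = z , z< ,
      subst₂ (λ s t → F s t ≡ e) kid≡ leaf≡ col ,
      convert U∈ kid≡ j′ ,
      (λ eq → z≢ (trans eq (sym ρy≡))) ,
      trans (sym (θ≗ϑ z)) (trans θ≡ (trans (θ≗ϑ (ρ y′)) (cong (ϑ e) ρy≡)))
      where
      kid≡ : follow ρ h (z ∷ y′) ≡ follow σ h (z ∷ y′)
      kid≡ = same-follow h (z ∷ y′) (n≤1+n _)

  -- Applied to the children of `y`, this makes their futures independent of which of them is
  -- chosen.
  schedule-off : OffEqual y ρ σ → ∀ h x y′ → length y < length y′ → y′ Extends y →
    schedule ρ h x y′ ≡ schedule σ h x y′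
  schedule-off off zero    x y′ lt ex = refl
  schedule-off {y} {ρ} {σ} off (suc h) x y′ lt ex = begin
    e₁ ∷ schedule ρ h (e₁ ∷ x) (ρ y′ ∷ y′)   ≡⟨ cong (λ d → e₁ ∷ schedule ρ h (e₁ ∷ x) (d ∷ y′)) (off y′ (longer≢ lt)) ⟩
    e₁ ∷ schedule ρ h (e₁ ∷ x) (σ y′ ∷ y′)   ≡⟨ cong (λ e → e ∷ schedule ρ h (e ∷ x) (σ y′ ∷ y′)) e≡ ⟩
    e₂ ∷ schedule ρ h (e₂ ∷ x) (σ y′ ∷ y′) ≡⟨ cong (e₂ ∷_) (same e₂ (σ y′)) ⟩
    e₂ ∷ schedule σ h (e₂ ∷ x) (σ y′ ∷ y′) ∎
    where
    open ≡-Reasoning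
    θ : Rep → Colour → ℕ → History
    θ ρ e z = schedule ρ h (e ∷ x) (z ∷ y′)
    e₁ e₂ : Colour
    e₁ = pick (good? ρ h x y′ (θ ρ))
    e₂ = pick (good? σ h x y′ (θ σ))
    same : ∀ e z → θ ρ e z ≡ θ σ e z
    same e z = schedule-off off h (e ∷ x) (z ∷ y′) (m≤n⇒m≤1+n lt) (child ex)
    e≡ : e₁ ≡ e₂
    e≡ = pick-cong (good? ρ h x y′ (θ ρ)) (good? σ h x y′ (θ σ))
      (λ e → good-off h x {θ = θ ρ} {ϑ = θ σ} off lt ex (same e))
      (λ e → good-off h x {θ = θ σ} {ϑ = θ ρ} (λ u u≢ → sym (off u u≢)) lt ex (sym ∘ same e))

-- The union bound over nodes, histories and companies

sumOf-cong-∈ : ∀ {g h : A → ℕ} xs → (∀ {x} → x ∈ xs → g x ≡ h x) → sumOf xs g ≡ sumOf xs h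
sumOf-cong-∈ []       g≡h = refl
sumOf-cong-∈ (x ∷ xs) g≡h = cong₂ _+_ (g≡h (here refl)) (sumOf-cong-∈ xs (g≡h ∘ there))

length-product : ∀ (xs : List A) (ys : List B) → length (cartesianProduct xs ys) ≡ length xs * length ys
length-product []       ys = refl
length-product (x ∷ xs) ys = begin
  length (map (x ,_) ys ++ cartesianProduct xs ys)
    ≡⟨ length-++ (map (x ,_) ys) ⟩
  length (map (x ,_) ys) + length (cartesianProduct xs ys)
    ≡⟨ cong₂ _+_ (length-map (x ,_) ys) (length-product xs ys) ⟩
  length ys + length xs * length ys ∎
  where open ≡-Reasoning

module Counting (c : ℕ) (c₀ : Fin c) (size : ℕ → ℕ) (F : Node → Node → Fin c)
  (size>0 : ∀ k → 0 < size k) (ℓ : ℕ) where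

  open Bounds c size
  open Tree c c₀ size F
  open Reassign (λ y → size (length y))

  private variable
    ρ σ : Rep
    y : Node
    h k : ℕ

  Inside : Node → Set
  Inside []      = ⊤
  Inside (d ∷ y) = d < size (length y) × Inside y

  nodes : ℕ → List Node
  nodes zero    = [ [] ]
  nodes (suc k) = concatMap (λ y → map (_∷ y) (upTo (size k))) (nodes k)

  length-nodes : ∀ k → length (nodes k) ≤ width k
  length-nodes zero    = ≤-refl
  length-nodes (suc k) = ≤-trans
    (length-concatMap-≤ _ (nodes k) (λ {y} _ → ≤-reflexive (trans (length-map (_∷ y) (upTo (size k))) (length-upTo (size k)))))
    (*-monoˡ-≤ (size k) (length-nodes k))

  ∈-nodes : ∀ y → Inside y → y ∈ nodes (length y)
  ∈-nodes []      _         = here refl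
  ∈-nodes (d ∷ y) (d< , in-y) = ∈-concatMap⁺ (λ z → map (_∷ z) (upTo (size (length y))))
    (lose (∈-nodes y in-y) (∈-map⁺ (_∷ y) (∈-upTo⁺ d<)))

  length-∈-nodes : ∀ k {y} → y ∈ nodes k → length y ≡ k
  length-∈-nodes zero    (here refl) = refl
  length-∈-nodes (suc k) y∈ with find (∈-concatMap⁻ (λ y → map (_∷ y) (upTo (size k))) {nodes k} y∈)
  ... | z , z∈ , y∈′ with ∈-map⁻ (_∷ z) y∈′
  ...   | _ , _ , refl = cong suc (length-∈-nodes k z∈)

  inner : List Node
  inner = concatMap nodes (upTo ℓ)

  Profile : Set
  Profile = History × List History

  _≟ᴾ_ : DecidableEquality Profile
  _≟ᴾ_ = ×-≡-dec _≟ᴴ_ (≡-dec _≟ᴴ_)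

  -- This is what twins have to share: the colours towards the leaves of the company and, for each
  -- colour that the level might receive, the schedule below.
  profile : Rep → ℕ → History → Node → Company → ℕ → Profile
  profile ρ h x y U z =
    map (λ p → F (follow ρ h (z ∷ y)) (follow ρ (suc h) (proj₂ p))) U ,
    map (λ e → schedule ρ h (e ∷ x) (z ∷ y)) colours

  unrepeated? : ∀ ρ h x y U v → Dec (¬ Repeated _≟ᴾ_ (profile ρ h x y U) (size (length y)) v)
  unrepeated? ρ h x y U v = ¬? (repeated? _≟ᴾ_ (profile ρ h x y U) (size (length y)) v)

  -- The chosen value `v` is separated from `ρ`, because everything else here is independent of the
  -- choice at `y` (`badness-off`).
  badness : Rep → ℕ → Node → ℕ → ℕ
  badness ρ h y v = sumOf (words (length y) colours) λ x →
    sumOf (companies ρ x y) λ U → ⟦ unrepeated? ρ h x y U v ⟧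

  profile-off : ∀ h x y {U} z → OffEqual y ρ σ → U ∈ companies ρ x y →
    profile ρ h x y U z ≡ profile σ h x y U z
  profile-off {ρ} {σ} h x y z off U∈ = cong₂ _,_
    (map-cong-local (All.tabulate λ {p} p∈ →
      let len , p≢ = company-node ρ x y U∈ p∈ in
      cong₂ F (follow-off off h ≤-refl) (follow-off′ off h len p≢)))
    (map-cong (λ e → schedule-off off h (e ∷ x) (z ∷ y) ≤-refl (child self)) colours)

  badness-off : ∀ h y v → OffEqual y ρ σ → badness ρ h y v ≡ badness σ h y v
  badness-off {ρ} {σ} h y v off = sumOf-cong (λ x → trans
      (sumOf-cong-∈ (companies ρ x y) (λ {U} U∈ →
        ⟦⟧-cong {P? = unrepeated? ρ h x y U v} {Q? = unrepeated? σ h x y U v}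
          (_∘ transfer {p = profile σ h x y U} {q = profile ρ h x y U} (λ z → sym (profile-off h x y z off U∈)))
          (_∘ transfer {p = profile ρ h x y U} {q = profile σ h x y U} (λ z → profile-off h x y z off U∈))))
      (cong (λ Us → sumOf Us (λ U → ⟦ unrepeated? σ h x y U v ⟧)) (companies-off off x y (inj₂ self))))
    (words (length y) colours)
    where
    transfer : ∀ {p q : ℕ → Profile} {K} → (∀ z → p z ≡ q z) → Repeated _≟ᴾ_ p K v → Repeated _≟ᴾ_ q K v
    transfer p≗q (w , w< , w≢ , eq) = w , w< , w≢ , trans (sym (p≗q w)) (trans eq (p≗q v))

  badness-extensional : ∀ h y → Extensional (λ ρ → badness ρ h y (ρ y))
  badness-extensional h y {ρ} {σ} ρ≗σ = trans (cong (badness ρ h y) (ρ≗σ y))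
    (badness-off h y (σ y) (λ u _ → ρ≗σ u))

  length-colours : length colours ≡ c
  length-colours = length-tabulate {n = c} id

  length-schedule : ∀ ρ h x y → length (schedule ρ h x y) ≡ h
  length-schedule ρ zero    x y = refl
  length-schedule ρ (suc h) x y = cong suc (length-schedule ρ h _ (ρ y ∷ y))

  profiles : Company → ℕ → List Profile
  profiles U h = cartesianProduct (words (length U) colours) (words c (words h colours))

  length-profiles : ∀ x y {U} h → U ∈ companies ρ x y → length (profiles U h) ≤ profileBound (length y) h
  length-profiles {ρ} x y {U} h U∈ = begin
    length (profiles U h)
      ≡⟨ length-product (words (length U) colours) _ ⟩
    length (words (length U) colours) * length (words c (words h colours))
      ≤⟨ *-mono-≤ (length-words (length U) colours) (length-words c (words h colours)) ⟩
    length colours ^ length U * length (words h colours) ^ c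
      ≤⟨ *-monoʳ-≤ (length colours ^ length U) (^-monoˡ-≤ c (length-words h colours)) ⟩
    length colours ^ length U * (length colours ^ h) ^ c
      ≡⟨ cong (λ k → k ^ length U * (k ^ h) ^ c) length-colours ⟩
    c ^ length U * (c ^ h) ^ c
      ≤⟨ *-monoˡ-≤ ((c ^ h) ^ c) (^-monoʳ-≤ c (company-size ρ x y U∈)) ⟩
    profileBound (length y) h ∎
    where
    open ≤-Reasoning
    instance
      c≢0 : NonZero c
      c≢0 = Fin.nonZeroIndex c₀

  ∈-profiles : ∀ ρ h x y U z → profile ρ h x y U z ∈ profiles U h
  ∈-profiles ρ h x y U z = ∈-cartesianProduct⁺
    (subst (λ k → map colour U ∈ words k colours) (length-map colour U) (∈-words (map colour U) (λ _ → ∈-allFin _)))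
    (subst (λ k → map plan colours ∈ words k (words h colours)) (trans (length-map plan colours) length-colours)
      (∈-words (map plan colours) plan∈))
    where
    colour : Colour × Node → Colour
    colour p = F (follow ρ h (z ∷ y)) (follow ρ (suc h) (proj₂ p))
    plan : Colour → History
    plan e = schedule ρ h (e ∷ x) (z ∷ y)
    plan∈ : ∀ {w} → w ∈ map plan colours → w ∈ words h colours
    plan∈ w∈ with ∈-map⁻ plan w∈
    ... | e , _ , refl = subst (λ k → plan e ∈ words k colours) (length-schedule ρ h (e ∷ x) (z ∷ y))
      (∈-words (plan e) (λ _ → ∈-allFin _))

  -- For each history and company, the unrepeated values of `v` are at most as many as the profiles.
  slice-badness : ∀ h y ρ → slice y (λ ρ → badness ρ h y (ρ y)) ρ ≤ levelBound (length y) h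
  slice-badness h y ρ = begin
    slice y (λ ρ → badness ρ h y (ρ y)) ρ
      ≡⟨ sumOf-cong reset (upTo K) ⟩
    sumOf (upTo K) (badness ρ h y)
      ≡⟨ sumOf-swap (λ v x → sumOf (companies ρ x y) (λ U → ⟦ unrepeated? ρ h x y U v ⟧)) (upTo K) W ⟩
    sumOf W (λ x → sumOf (upTo K) (λ v → sumOf (companies ρ x y) (λ U → ⟦ unrepeated? ρ h x y U v ⟧)))
      ≡⟨ sumOf-cong (λ x → sumOf-swap (λ v U → ⟦ unrepeated? ρ h x y U v ⟧) (upTo K) (companies ρ x y)) W ⟩
    sumOf W (λ x → sumOf (companies ρ x y) (λ U → sumOf (upTo K) (λ v → ⟦ unrepeated? ρ h x y U v ⟧)))
      ≤⟨ sumOf-≤ W (λ {x} _ → ≤-trans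
           (sumOf-≤ (companies ρ x y) (λ {U} U∈ → ≤-trans
             (count-unrepeated _≟ᴾ_ (profile ρ h x y U) K (profiles U h) (∈-profiles ρ h x y U))
             (length-profiles {ρ} x y h U∈)))
           (*-monoˡ-≤ (profileBound j h) (length-companies ρ x y))) ⟩
    length W * (companyBound j * profileBound j h)
      ≤⟨ *-monoˡ-≤ (companyBound j * profileBound j h) (length-words j colours) ⟩
    length colours ^ j * (companyBound j * profileBound j h)
      ≡⟨ cong (λ s → s ^ j * (companyBound j * profileBound j h)) length-colours ⟩
    levelBound j h ∎
    where
    open ≤-Reasoning
    j K : ℕ
    j = length y
    K = size j
    W : List History
    W = words j colours
    reset : ∀ v → badness (ρ [ y ≔ v ]) h y ((ρ [ y ≔ v ]) y) ≡ badness ρ h y v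
    reset v = trans (cong (badness (ρ [ y ≔ v ]) h y) (≔-this ρ y v))
      (badness-off h y v (λ u u≢ → ≔-other ρ v u≢))

  -- This is the height of the children of a node of level `k`, not of the node itself.
  height : ℕ → ℕ
  height k = ℓ ∸ suc k

  card>0 : ∀ Y → 0 < card Y
  card>0 []      = s≤s z≤n
  card>0 (y ∷ Y) = *-mono-< (size>0 (length y)) (card>0 Y)

  AllRepeated : Rep → Node → Set
  AllRepeated ρ y = ∀ {x U} → length x ≡ length y → U ∈ companies ρ x y →
    Repeated _≟ᴾ_ (profile ρ (height (length y)) x y U) (size (length y)) (ρ y)

  module _ (fits : ∀ {k} → k < ℓ → suc ℓ * (width k * levelBound k (height k)) ≤ size k) where

    levelTotal : ℕ → Rep → ℕ
    levelTotal k ρ = sumOf (nodes k) λ y → badness ρ (height k) y (ρ y)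

    ρ₀ : Rep
    ρ₀ _ = 0

    T : ℕ
    T = card inner

    -- At each of at most `width k` nodes the expected badness is at most
    -- `levelBound k (height k) / size k`, so by `fits` the whole level contributes at most
    -- `1 / (ℓ + 1)`.
    total-level : k < ℓ → suc ℓ * total inner (levelTotal k) ρ₀ ≤ T
    total-level {k} k<ℓ = *-cancelˡ-≤ (size k) {{>-nonZero (size>0 k)}} (begin
      size k * (suc ℓ * G)      ≡⟨ x[yz]≡y[xz] (size k) (suc ℓ) G ⟩
      suc ℓ * (size k * G)      ≤⟨ *-monoʳ-≤ (suc ℓ) size*G ⟩
      suc ℓ * (width k * L * T) ≡⟨ *-assoc (suc ℓ) (width k * L) T ⟨
      suc ℓ * (width k * L) * T ≤⟨ *-monoˡ-≤ T (fits k<ℓ) ⟩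
      size k * T                ∎)
      where
      open ≤-Reasoning
      G L : ℕ
      G = total inner (levelTotal k) ρ₀
      L = levelBound k (height k)
      x[yz]≡y[xz] : ∀ a b d → a * (b * d) ≡ b * (a * d)
      x[yz]≡y[xz] a b d = trans (sym (*-assoc a b d)) (trans (cong (_* d) (*-comm a b)) (*-assoc b a d))
      one : ∀ {y} → y ∈ nodes k → size k * total inner (λ ρ → badness ρ (height k) y (ρ y)) ρ₀ ≤ L * T
      one {y} y∈ with length-∈-nodes k y∈
      ... | refl = total-slice-≤ inner ρ₀ (badness-extensional (height k) y)
        (∈-concatMap⁺ nodes (lose (∈-upTo⁺ k<ℓ) y∈)) (slice-badness (height k) y)
      size*G : size k * G ≤ width k * L * T
      size*G = begin
        size k * G
          ≡⟨ cong (size k *_) (total-sumOf inner (λ y ρ → badness ρ (height k) y (ρ y)) (nodes k) ρ₀) ⟩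
        size k * sumOf (nodes k) (λ y → total inner (λ ρ → badness ρ (height k) y (ρ y)) ρ₀)
          ≡⟨ sumOf-* (size k) _ (nodes k) ⟩
        sumOf (nodes k) (λ y → size k * total inner (λ ρ → badness ρ (height k) y (ρ y)) ρ₀)
          ≤⟨ sumOf-≤ (nodes k) one ⟩
        length (nodes k) * (L * T)  ≤⟨ *-monoˡ-≤ (L * T) (length-nodes k) ⟩
        width k * (L * T)           ≡⟨ *-assoc (width k) L T ⟨
        width k * L * T             ∎

    total-badness : total inner (λ ρ → sumOf (upTo ℓ) (λ k → levelTotal k ρ)) ρ₀ < T
    total-badness = *-cancelˡ-< (suc ℓ) _ _ (begin-strict
      suc ℓ * total inner (λ ρ → sumOf (upTo ℓ) (λ k → levelTotal k ρ)) ρ₀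
        ≡⟨ cong (suc ℓ *_) (total-sumOf inner levelTotal (upTo ℓ) ρ₀) ⟩
      suc ℓ * sumOf (upTo ℓ) (λ k → total inner (levelTotal k) ρ₀)
        ≡⟨ sumOf-* (suc ℓ) _ (upTo ℓ) ⟩
      sumOf (upTo ℓ) (λ k → suc ℓ * total inner (levelTotal k) ρ₀)
        ≤⟨ sumOf-≤ (upTo ℓ) (λ k∈ → total-level (∈-upTo⁻ k∈)) ⟩
      length (upTo ℓ) * T  ≡⟨ cong (_* T) (length-upTo ℓ) ⟩
      -- The allowance `1 / (ℓ + 1)` for each of only `ℓ` levels makes the inequality strict.
      ℓ * T                <⟨ m<n+m (ℓ * T) (card>0 inner) ⟩
      suc ℓ * T            ∎)
      where open ≤-Reasoning

    good-choice : ∃ λ ρ → Valid ρ × (∀ y → Inside y → length y < ℓ → AllRepeated ρ y)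
    good-choice with total-<-∃ inner ρ₀ (λ u → size>0 (length u)) total-badness
    ... | ρ , valid , none = ρ , valid , λ y in-y y<ℓ {x} {U} len U∈ →
      decidable-stable (repeated? _≟ᴾ_ (profile ρ (height (length y)) x y U) (size (length y)) (ρ y))
        (⟦⟧≡0 {P? = unrepeated? ρ (height (length y)) x y U (ρ y)}
          (sumOf≡0 (sumOf≡0 (sumOf≡0 (sumOf≡0 none (∈-upTo⁺ y<ℓ)) (∈-nodes y in-y))
            (subst (λ k → x ∈ words k colours) len (∈-words x (λ _ → ∈-allFin _)))) U∈))

-- Growing a chain

-- Split h u v: the directions of u and v first differ h + 1 levels above their
-- common level, where that of u is the smaller one.
data Split : ℕ → Node → Node → Set where
  here  : ∀ {d d′ y} → d < d′ → Split 0 (d ∷ y) (d′ ∷ y)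
  there : ∀ {h u v a b} → Split h u v → Split (suc h) (a ∷ u) (b ∷ v)

module Growing (c : ℕ) (c₀ : Fin c) (size : ℕ → ℕ) (F : Node → Node → Fin c)
  (size>0 : ∀ k → 0 < size k) (ℓ : ℕ) where

  open Tree c c₀ size F
  open Counting c c₀ size F size>0 ℓ

  private variable
    ρ : Rep
    y u w : Node
    e g : Colour

  ∈-advance⁺ : ∀ {U} → (e , w) ∈ U → (e , ρ w ∷ w) ∈ advance ρ U
  ∈-advance⁺ = ∈-map⁺ _

  ∈-advance⁻ : ∀ {U} → (e , u) ∈ advance ρ U → ∃ λ w → (e , w) ∈ U × u ≡ ρ w ∷ w
  ∈-advance⁻ u∈ with ∈-map⁻ _ u∈
  ... | (_ , w) , w∈ , refl = w , w∈ , refl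

  SameIn : Colour → Company → Company → Set
  SameIn e U V = (∀ {u} → (e , u) ∈ U → (e , u) ∈ V) × (∀ {u} → (e , u) ∈ V → (e , u) ∈ U)

  advance-same : ∀ {U V} → SameIn e U V → SameIn e (advance ρ U) (advance ρ V)
  advance-same {e} {ρ} (U⊆V , V⊆U) = lift U⊆V , lift V⊆U
    where
    lift : ∀ {U V} → (∀ {u} → (e , u) ∈ U → (e , u) ∈ V) →
      ∀ {u} → (e , u) ∈ advance ρ U → (e , u) ∈ advance ρ V
    lift U⊆V u∈ with ∈-advance⁻ u∈
    ... | w , w∈ , refl = ∈-advance⁺ (U⊆V w∈)

  grow-other : ∀ {d U V} → e ≢ g → Grow ρ g d y U V → SameIn e (advance ρ U) V
  grow-other e≢g stay         = id , id
  grow-other {e} e≢g (join {w = w} _ _ _) = there , back e≢g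
    where
    back : ∀ {g w u A} → e ≢ g → (e , u) ∈ ((g , w) ∷ A) → (e , u) ∈ A
    back e≢g (here refl) = ⊥-elim (e≢g refl)
    back e≢g (there u∈)  = u∈

  same-trans : ∀ {U V W} → SameIn e U V → SameIn e V W → SameIn e U W
  same-trans (f , f′) (h , h′) = h ∘ f , f′ ∘ h′

  same-cons : ∀ {U V p} → SameIn e U V → SameIn e (p ∷ U) (p ∷ V)
  same-cons (f , f′) = cons f , cons f′
    where
    cons : ∀ {e U V p} → (∀ {u} → (e , u) ∈ U → (e , u) ∈ V) → ∀ {u} → (e , u) ∈ (p ∷ U) → (e , u) ∈ (p ∷ V)
    cons f (here eq)  = here eq
    cons f (there u∈) = there (f u∈)

  -- Each level adds at most one node, of the colour that the history assigns
  -- to the level, so the companies chosen for the various colours can be merged.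
  merge : ∀ ρ x y (U : Colour → Company) → (∀ e → U e ∈ companies ρ x y) →
    ∃ λ V → V ∈ companies ρ x y × (∀ e → SameIn e V (U e))
  merge ρ []      []      U U∈ = [] , here refl , λ e → (λ ()) , λ u∈ → nothing (U∈ e) u∈
    where
    nothing : ∀ {U : Company} {p} → U ∈ [ [] ] → p ∈ U → p ∈ []
    nothing (here refl) p∈ = p∈
  merge ρ []      (_ ∷ _) U U∈ with () ← U∈ c₀
  merge ρ (_ ∷ _) []      U U∈ with () ← U∈ c₀
  merge ρ (g ∷ x) (d ∷ y) U U∈ with merge ρ x y (λ e → proj₁ (companies⁻ {x = x} (U∈ e)))
                                                (λ e → proj₁ (proj₂ (companies⁻ {x = x} (U∈ e))))
  -- At this level only colour `g` can gain a member, so the growth of the company chosen for `g` is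
  -- copied. The parent of its newcomer is `y` or has colour `g`, and so is available in the merged
  -- company.
  ... | V , V∈ , same = extend (growth g) refl
    where
    base : Colour → Company
    base e = proj₁ (companies⁻ {x = x} (U∈ e))
    growth : ∀ e → Grow ρ g d y (base e) (U e)
    growth e = proj₂ (proj₂ (companies⁻ {x = x} (U∈ e)))
    others : ∀ {W e} → e ≢ g → Grow ρ g d y V W → SameIn e W (U e)
    others {e = e} e≢g gr = same-trans (proj₂ gr′ , proj₁ gr′)
      (same-trans (advance-same (same e)) (grow-other e≢g (growth e)))
      where gr′ = grow-other e≢g gr
    extend : ∀ {W} → Grow ρ g d y (base g) W → W ≡ U g →
      ∃ λ W → W ∈ companies ρ (g ∷ x) (d ∷ y) × (∀ e → SameIn e W (U e))
    extend stay eq = advance ρ V , companies⁺ {x = x} V∈ stay , all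
      where
      all : ∀ e → SameIn e (advance ρ V) (U e)
      all e with e Fin.≟ g
      ... | no  e≢g  = others e≢g stay
      ... | yes refl = subst (SameIn g (advance ρ V)) eq (advance-same (same g))
    extend (join {a} {w} a< w∈ ≢) eq = (g , a ∷ w) ∷ advance ρ V , companies⁺ {x = x} V∈ gr , all
      where
      w∈′ : ∀ {w} → w ≡ y ⊎ (g , w) ∈ base g → w ≡ y ⊎ (g , w) ∈ V
      w∈′ (inj₁ w≡y) = inj₁ w≡y
      w∈′ (inj₂ w∈)  = inj₂ (proj₂ (same g) w∈)
      gr : Grow ρ g d y V ((g , a ∷ w) ∷ advance ρ V)
      gr = join a< (w∈′ w∈) ≢
      all : ∀ e → SameIn e ((g , a ∷ w) ∷ advance ρ V) (U e)
      all e with e Fin.≟ g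
      ... | no  e≢g  = others e≢g gr
      ... | yes refl = subst (SameIn g ((g , a ∷ w) ∷ advance ρ V)) eq (same-cons (advance-same (same g)))

  -- Existence of good colours

  plans : Rep → ℕ → History → Node → Colour → ℕ → History
  plans ρ h x y e z = schedule ρ h (e ∷ x) (z ∷ y)

  -- If every colour failed on some company, the failing companies could be merged. A child `z`
  -- repeating the profile of `ρ y` for the merged company would then be a twin for the colour of
  -- the pair that it forms with `ρ y`.
  good-exists : ∀ {x} → AllRepeated ρ y → length x ≡ length y →
    ∃ (Good ρ (height (length y)) x y (plans ρ (height (length y)) x y))
  good-exists {ρ} {y} {x} repeated len with Fin.any? (good? ρ h x y θ)
    where
    h = height (length y)
    θ = plans ρ h x y
  ... | yes good = good
  ... | no ¬good = ⊥-elim (¬twin e₁ (z , z< , refl , joined , z≢ , map-≡⇒≡ (cong proj₂ eq) (∈-allFin e₁)))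
    where
    h : ℕ
    h = height (length y)
    θ : Colour → ℕ → History
    θ = plans ρ h x y
    Fails : Colour → Company → Set
    Fails e U = ¬ (Joined ρ h e (follow ρ (suc h) y) U →
      ∃ λ z → z < size (length y) × Twin ρ h y e (θ e) U z)
    failing : ∀ e → ∃ λ U → U ∈ companies ρ x y × Fails e U
    failing e = find (¬All⇒Any¬ (λ U → joined? ρ h e (follow ρ (suc h) y) U →-dec
      anyUpTo? (λ z → (F (follow ρ h (z ∷ y)) (follow ρ (suc h) y) Fin.≟ e) ×-dec
        (joined? ρ h e (follow ρ h (z ∷ y)) U ×-dec
          (¬? (z ≟ ρ y) ×-dec (θ e z ≟ᴴ θ e (ρ y))))) (size (length y))) (companies ρ x y)
      (λ good → ¬good (e , good)))
    U : Colour → Company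
    U e = proj₁ (failing e)
    -- A company on which goodness fails must satisfy the hypothesis of that implication.
    U-joined : ∀ e → Joined ρ h e (follow ρ (suc h) y) (U e)
    U-joined e = decidable-stable (joined? ρ h e (follow ρ (suc h) y) (U e))
      (λ ¬j → proj₂ (proj₂ (failing e)) (λ j → ⊥-elim (¬j j)))
    ¬twin : ∀ e → ¬ ∃ λ z → z < size (length y) × Twin ρ h y e (θ e) (U e) z
    ¬twin e twin = proj₂ (proj₂ (failing e)) (λ _ → twin)
    merged : ∃ λ V → V ∈ companies ρ x y × (∀ e → SameIn e V (U e))
    merged = merge ρ x y U (λ e → proj₁ (proj₂ (failing e)))
    V : Company
    V = proj₁ merged
    repetition : Repeated _≟ᴾ_ (profile ρ h x y V) (size (length y)) (ρ y)
    repetition = repeated len (proj₁ (proj₂ merged))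
    z : ℕ
    z = proj₁ repetition
    z< = proj₁ (proj₂ repetition)
    z≢ = proj₁ (proj₂ (proj₂ repetition))
    eq = proj₂ (proj₂ (proj₂ repetition))
    -- This colour is known only after `z` has been found, which is why one company has to serve all
    -- colours at once.
    e₁ : Colour
    e₁ = F (follow ρ h (z ∷ y)) (follow ρ (suc h) y)
    joined : Joined ρ h e₁ (follow ρ h (z ∷ y)) (U e₁)
    joined = All.tabulate λ { {_ , u} p∈ refl → trans
      (map-≡⇒≡ (cong proj₁ eq) (proj₂ (proj₂ (proj₂ merged) e₁) p∈))
      (All.lookup (U-joined e₁) p∈ refl) }

  -- The chain, level by level

  module Build (F-sym : ∀ u v → F u v ≡ F v u) (ρ : Rep) (valid : ∀ u → ρ u < size (length u))
    (repeated : ∀ y → Inside y → length y < ℓ → AllRepeated ρ y)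
    {k : ℕ} {_<*_ : Rel (Fin k) 0ℓ} (sto : IsStrictTotalOrder _≡_ _<*_) (e : Colour) where

    module <* = IsStrictTotalOrder sto

    -- Members i and i + 1 of the chain part at the level of the gap i.  The
    -- pending gaps gs have not been opened yet, so the members on both sides
    -- of such a gap still coincide.
    record State (h : ℕ) (x xs : History) (Λ : Fin (suc k) → Node) (gs : List (Fin k)) (H : Fin k → ℕ) : Set where
      field
        inside  : ∀ i → Inside (Λ i)
        level   : ∀ i → length (Λ i) + h ≡ ℓ
        len     : length x + h ≡ ℓ
        plan    : ∀ i → schedule ρ h x (Λ i) ≡ xs
        mono    : ∀ i j → Λ i ≢ Λ j → F (follow ρ h (Λ i)) (follow ρ h (Λ j)) ≡ e
        company : ∀ i → ∃ λ U → U ∈ companies ρ x (Λ i) ×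
                    (∀ {u} → (e , u) ∈ U → u ≢ Λ i × ∃ λ j → u ≡ Λ j) ×
                    (∀ j → Λ j ≢ Λ i → (e , Λ j) ∈ U)
        closed  : ∀ {g} → g ∈ gs → Λ (inject₁ g) ≡ Λ (Fin.suc g)
        opened  : ∀ {g} → g ∉ gs → Split (H g) (Λ (inject₁ g)) (Λ (Fin.suc g))
        later   : ∀ {g g′} → g ∈ gs → g′ ∉ gs → g <* g′
        ordered : ∀ {g g′} → g ∉ gs → g′ ∉ gs → g <* g′ → H g < H g′
        sorted  : AllPairs (λ g g′ → g′ <* g) gs

    height≡ : ∀ {h} → length y + suc h ≡ ℓ → height (length y) ≡ h
    height≡ {y} {h} eq = trans (cong (_∸ suc (length y)) (trans (sym eq) (+-suc (length y) h)))
      (m+n∸m≡n (suc (length y)) h)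

    -- By `good-exists` some colour is good, so `pick` has found a good one.
    schedule-good : ∀ {h x} → Inside y → length y + suc h ≡ ℓ → length x ≡ length y →
      ∀ {e xs} → schedule ρ (suc h) x y ≡ e ∷ xs → Good ρ h x y (plans ρ h x y) e
    schedule-good {y} {h} {x} in-y lev len {e} eq =
      subst (Good ρ h x y (plans ρ h x y)) (∷-injectiveˡ eq)
        (pick-sound (good? ρ h x y (plans ρ h x y)) (proj₂ good))
      where
      good : ∃ (Good ρ h x y (plans ρ h x y))
      good = subst (λ h → ∃ (Good ρ h x y (plans ρ h x y))) (height≡ {y} lev)
        (good-exists (repeated y in-y (subst (length y <_) lev (m<m+n (length y) z<s))) len)

    schedule-next : ∀ {h x e xs} → schedule ρ (suc h) x y ≡ e ∷ xs →
      schedule ρ h (e ∷ x) (ρ y ∷ y) ≡ xs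
    schedule-next eq with ∷-injective eq
    ... | refl , eq′ = eq′

    private variable
      h : ℕ
      x xs : History
      Λ : Fin (suc k) → Node
      gs : List (Fin k)
      H : Fin k → ℕ

    -- Moving every member to its chosen child changes none of the representing leaves. This passes
    -- a level at which no gap is opened.
    drift : ∀ {a} → State (suc h) x (a ∷ xs) Λ gs H →
      State h (a ∷ x) xs (λ i → ρ (Λ i) ∷ Λ i) gs (suc ∘ H)
    drift {h} {x} {xs} {Λ} {gs} {H} {a} s = record
      { inside  = λ i → valid (Λ i) , inside i
      ; level   = λ i → trans (sym (+-suc _ h)) (level i)
      ; len     = trans (sym (+-suc _ h)) len
      ; plan    = λ i → schedule-next (plan i)
      ; mono    = λ i j n≢ → mono i j (λ eq → n≢ (cong (λ v → ρ v ∷ v) eq))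
      ; company = company′
      ; closed  = λ g∈ → cong (λ v → ρ v ∷ v) (closed g∈)
      ; opened  = there ∘ opened
      ; later   = later
      ; ordered = λ g∉ g′∉ lt → s<s (ordered g∉ g′∉ lt)
      ; sorted  = sorted
      }
      where
      open State s
      company′ : ∀ i → ∃ λ U → U ∈ companies ρ (a ∷ x) (ρ (Λ i) ∷ Λ i) ×
        (∀ {u} → (e , u) ∈ U → u ≢ ρ (Λ i) ∷ Λ i × ∃ λ j → u ≡ ρ (Λ j) ∷ Λ j) ×
        (∀ j → ρ (Λ j) ∷ Λ j ≢ ρ (Λ i) ∷ Λ i → (e , ρ (Λ j) ∷ Λ j) ∈ U)
      company′ i with company i
      ... | U , U∈ , sound , complete = advance ρ U , companies⁺ {x = x} U∈ stay , sound′ ,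
        λ j n≢ → ∈-advance⁺ (complete j (λ eq → n≢ (cong (λ v → ρ v ∷ v) eq)))
        where
        sound′ : ∀ {u} → (e , u) ∈ advance ρ U → u ≢ ρ (Λ i) ∷ Λ i × ∃ λ j → u ≡ ρ (Λ j) ∷ Λ j
        sound′ u∈ with ∈-advance⁻ u∈
        ... | w , w∈ , refl with sound w∈
        ...   | w≢ , j , refl = w≢ ∘ ∷-injectiveʳ , j , refl

    -- In colour `e`, the company kept for `node` consists of the other nodes of the chain, and by
    -- `mono` its leaf is joined to them. As `e` is the colour scheduled here, it is good and a twin
    -- exists.
    twin-exists : ∀ {γ} → State (suc h) x (e ∷ xs) Λ (γ ∷ gs) H → let node = Λ (inject₁ γ) in
      ∃ λ z → z < size (length node) × z ≢ ρ node ×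
        F (follow ρ h (z ∷ node)) (follow ρ (suc h) node) ≡ e ×
        (∀ j → Λ j ≢ node → F (follow ρ h (z ∷ node)) (follow ρ (suc h) (Λ j)) ≡ e) ×
        schedule ρ h (e ∷ x) (z ∷ node) ≡ xs
    twin-exists {h} {x} {γ = γ} s with State.company s (inject₁ γ)
    ... | U , U∈ , sound , complete with
      All.lookup (schedule-good (inside (inject₁ γ)) (level (inject₁ γ)) len≡ (plan (inject₁ γ))) U∈
        (All.tabulate λ { {_ , u} p∈ refl → joined p∈ })
      where
      open State s
      len≡ = +-cancelʳ-≡ (suc h) _ _ (trans len (sym (level (inject₁ γ))))
      joined : ∀ {u} → (e , u) ∈ U → F (follow ρ (suc h) _) (follow ρ (suc h) u) ≡ e
      joined u∈ with sound u∈
      ... | u≢ , j , refl = mono (inject₁ γ) j (u≢ ∘ sym)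
    ...   | z , z< , col , joined , z≢ , plan≡ = z , z< , z≢ , col ,
      (λ j n≢ → All.lookup joined (complete j n≢) refl) ,
      trans plan≡ (schedule-next (State.plan s (inject₁ γ)))

    -- Opening the largest pending gap

    module Opening {γ : Fin k} (s : State (suc h) x (e ∷ xs) Λ (γ ∷ gs) H) (z : ℕ)
      (z< : z < size (length (Λ (inject₁ γ)))) (z≢ : z ≢ ρ (Λ (inject₁ γ)))
      (z-node : F (follow ρ h (z ∷ Λ (inject₁ γ))) (follow ρ (suc h) (Λ (inject₁ γ))) ≡ e)
      (z-other : ∀ j → Λ j ≢ Λ (inject₁ γ) →
        F (follow ρ h (z ∷ Λ (inject₁ γ))) (follow ρ (suc h) (Λ j)) ≡ e)
      (z-plan : schedule ρ h (e ∷ x) (z ∷ Λ (inject₁ γ)) ≡ xs) where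

      open State s

      node : Node
      node = Λ (inject₁ γ)

      low high : ℕ
      low  = z ⊓ ρ node
      high = z ⊔ ρ node

      low<high : low < high
      low<high with <-cmp z (ρ node)
      ... | tri< lt _ _ = subst₂ _<_ (sym (m≤n⇒m⊓n≡m (<⇒≤ lt))) (sym (m≤n⇒m⊔n≡n (<⇒≤ lt))) lt
      ... | tri≈ _ eq _ = ⊥-elim (z≢ eq)
      ... | tri> _ _ gt = subst₂ _<_ (sym (m≥n⇒m⊓n≡n (<⇒≤ gt))) (sym (m≥n⇒m⊔n≡m (<⇒≤ gt))) gt

      choose : ∀ {P Q : Set} → Dec P → Dec Q → ℕ → ℕ
      choose (no  _) _       v = v
      choose (yes _) (yes _) v = low
      choose (yes _) (no  _) v = high

      -- The members coinciding at `node` are divided at the gap `γ`, those before it taking the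
      -- smaller direction, so that the chain stays in lexicographic order.
      kid : Fin (suc k) → ℕ
      kid i = choose (Λ i ≟ᴺ node) (toℕ i ≤? toℕ γ) (ρ (Λ i))

      Λ′ : Fin (suc k) → Node
      Λ′ i = kid i ∷ Λ i

      kid-low : ∀ {i} → Λ i ≡ node → toℕ i ≤ toℕ γ → kid i ≡ low
      kid-low {i} eq le with Λ i ≟ᴺ node | toℕ i ≤? toℕ γ
      ... | no n≢  | _      = ⊥-elim (n≢ eq)
      ... | yes _ | yes _  = refl
      ... | yes _ | no ¬le = ⊥-elim (¬le le)

      kid-high : ∀ {i} → Λ i ≡ node → ¬ toℕ i ≤ toℕ γ → kid i ≡ high
      kid-high {i} eq ¬le with Λ i ≟ᴺ node | toℕ i ≤? toℕ γ
      ... | no n≢  | _      = ⊥-elim (n≢ eq)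
      ... | yes _ | yes le = ⊥-elim (¬le le)
      ... | yes _ | no _   = refl

      kid-other : ∀ {i} → Λ i ≢ node → kid i ≡ ρ (Λ i)
      kid-other {i} n≢ with Λ i ≟ᴺ node
      ... | no _   = refl
      ... | yes eq = ⊥-elim (n≢ eq)

      -- For colours and companies it matters only whether a member takes its chosen child or the
      -- twin, not which of the two directions is smaller.
      data Role (i : Fin (suc k)) : Set where
        steady : kid i ≡ ρ (Λ i) → Role i
        clone  : Λ i ≡ node → kid i ≡ z → Role i

      low-or-high : ∀ {i} → Λ i ≡ node → kid i ≡ low ⊎ kid i ≡ high
      low-or-high {i} eq = by-position (toℕ i ≤? toℕ γ)
        where
        by-position : Dec (toℕ i ≤ toℕ γ) → kid i ≡ low ⊎ kid i ≡ high
        by-position (yes le) = inj₁ (kid-low eq le)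
        by-position (no ¬le) = inj₂ (kid-high eq ¬le)

      role : ∀ i → Role i
      role i with Λ i ≟ᴺ node
      ... | no n≢   = steady (kid-other n≢)
      ... | yes eq with low-or-high eq
      ...   | inj₁ kid≡ with ⊓-sel z (ρ node)
      ...     | inj₁ low≡ = clone eq (trans kid≡ low≡)
      ...     | inj₂ low≡ = steady (trans kid≡ (trans low≡ (cong ρ (sym eq))))
      role i | yes eq | inj₂ kid≡ with ⊔-sel z (ρ node)
      ...     | inj₁ high≡ = clone eq (trans kid≡ high≡)
      ...     | inj₂ high≡ = steady (trans kid≡ (trans high≡ (cong ρ (sym eq))))

      left≤ : toℕ (inject₁ γ) ≤ toℕ γ
      left≤ = ≤-reflexive (Fin.toℕ-inject₁ γ)

      right-node : Λ (Fin.suc γ) ≡ node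
      right-node = sym (closed (here refl))

      member-low : ∃ λ j → Λ′ j ≡ low ∷ node
      member-low = inject₁ γ , cong (_∷ node) (kid-low refl left≤)

      member-high : ∃ λ j → Λ′ j ≡ high ∷ node
      member-high = Fin.suc γ , cong₂ _∷_ (kid-high right-node 1+n≰n) right-node

      member-clone : ∃ λ j → Λ′ j ≡ z ∷ node
      member-clone with ⊓-sel z (ρ node) | ⊔-sel z (ρ node)
      ... | inj₁ eq | _       = proj₁ member-low , trans (proj₂ member-low) (cong (_∷ node) eq)
      ... | inj₂ _  | inj₁ eq = proj₁ member-high , trans (proj₂ member-high) (cong (_∷ node) eq)
      ... | inj₂ eq | inj₂ eq′ = ⊥-elim (<-irrefl (trans eq (sym eq′)) low<high)

      member-node : ∃ λ j → Λ′ j ≡ ρ node ∷ node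
      member-node with ⊓-sel z (ρ node) | ⊔-sel z (ρ node)
      ... | inj₂ eq | _       = proj₁ member-low , trans (proj₂ member-low) (cong (_∷ node) eq)
      ... | inj₁ _  | inj₂ eq = proj₁ member-high , trans (proj₂ member-high) (cong (_∷ node) eq)
      ... | inj₁ eq | inj₁ eq′ = ⊥-elim (<-irrefl (trans eq (sym eq′)) low<high)

      -- Both children of `node` are occupied by the two ends of the gap `γ`. Hence advancing an old
      -- company produces nodes of the new chain only.
      member-steady : ∀ j → ∃ λ j′ → Λ′ j′ ≡ ρ (Λ j) ∷ Λ j
      member-steady j = by-node (Λ j ≟ᴺ node)
        where
        by-node : Dec (Λ j ≡ node) → ∃ λ j′ → Λ′ j′ ≡ ρ (Λ j) ∷ Λ j
        by-node (no n≢)  = j , cong (_∷ Λ j) (kid-other n≢)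
        by-node (yes eq) = proj₁ member-node , trans (proj₂ member-node) (cong (λ v → ρ v ∷ v) (sym eq))

      Λ′-steady : ∀ {i} → kid i ≡ ρ (Λ i) → Λ′ i ≡ ρ (Λ i) ∷ Λ i
      Λ′-steady {i} = cong (_∷ Λ i)

      Λ′-clone : ∀ {i} → Λ i ≡ node → kid i ≡ z → Λ′ i ≡ z ∷ node
      Λ′-clone eq kid≡ = cong₂ _∷_ kid≡ eq

      inside′ : ∀ i → Inside (Λ′ i)
      inside′ i with role i
      ... | steady kid≡   = subst (_< size (length (Λ i))) (sym kid≡) (valid (Λ i)) , inside i
      ... | clone eq kid≡ = subst₂ (λ a v → a < size (length v)) (sym kid≡) (sym eq) z< , inside i

      plan′ : ∀ i → schedule ρ h (e ∷ x) (Λ′ i) ≡ xs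
      plan′ i with role i
      ... | steady kid≡   = trans (cong (schedule ρ h (e ∷ x)) (Λ′-steady kid≡)) (schedule-next (plan i))
      ... | clone eq kid≡ = trans (cong (schedule ρ h (e ∷ x)) (Λ′-clone eq kid≡))
        z-plan

      clone-steady : ∀ i → F (follow ρ h (z ∷ node)) (follow ρ (suc h) (Λ i)) ≡ e
      clone-steady i with Λ i ≟ᴺ node
      ... | no n≢   = z-other i n≢
      ... | yes eq = trans (cong (λ v → F (follow ρ h (z ∷ node)) (follow ρ (suc h) v)) eq) z-node

      mono′ : ∀ i j → Λ′ i ≢ Λ′ j → F (follow ρ h (Λ′ i)) (follow ρ h (Λ′ j)) ≡ e
      mono′ i j n≢ with role i | role j
      ... | steady p | steady q = subst₂ (λ u v → F (follow ρ h u) (follow ρ h v) ≡ e)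
        (sym (Λ′-steady p)) (sym (Λ′-steady q))
        (mono i j (λ eq → n≢ (trans (Λ′-steady p) (trans (cong (λ v → ρ v ∷ v) eq) (sym (Λ′-steady q))))))
      ... | steady p | clone q q′ = subst₂ (λ u v → F (follow ρ h u) (follow ρ h v) ≡ e)
        (sym (Λ′-steady p)) (sym (Λ′-clone q q′)) (trans (F-sym _ _) (clone-steady i))
      ... | clone p p′ | steady q = subst₂ (λ u v → F (follow ρ h u) (follow ρ h v) ≡ e)
        (sym (Λ′-clone p p′)) (sym (Λ′-steady q)) (clone-steady j)
      ... | clone p p′ | clone q q′ = ⊥-elim (n≢ (trans (Λ′-clone p p′) (sym (Λ′-clone q q′))))

      Companion : Fin (suc k) → Set
      Companion i = ∃ λ U → U ∈ companies ρ (e ∷ x) (Λ′ i) ×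
        (∀ {u} → (e , u) ∈ U → u ≢ Λ′ i × ∃ λ j → u ≡ Λ′ j) ×
        (∀ j → Λ′ j ≢ Λ′ i → (e , Λ′ j) ∈ U)

      -- The old company, advanced, lacks only one node of the new chain: `rest` says that every
      -- other node is either the newcomer `a ∷ w` or already there.
      enlarge : ∀ i {a} → a < size (length (Λ i)) → ∀ {w} →
        (∀ {U} → (∀ j → Λ j ≢ Λ i → (e , Λ j) ∈ U) → w ≡ Λ i ⊎ (e , w) ∈ U) →
        a ∷ w ≢ Λ′ i → (∃ λ j → a ∷ w ≡ Λ′ j) →
        (∀ j → Λ′ j ≢ Λ′ i → Λ′ j ≡ a ∷ w ⊎ (Λ j ≢ Λ i × kid j ≡ ρ (Λ j))) → Companion i
      enlarge i {a} a< {w} parent new mem rest with company i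
      ... | U , U∈ , sound , complete =
        (e , a ∷ w) ∷ advance ρ U , companies⁺ {x = x} U∈ (join a< (parent complete) new) , sound′ , complete′
        where
        sound′ : ∀ {u} → (e , u) ∈ ((e , a ∷ w) ∷ advance ρ U) → u ≢ Λ′ i × ∃ λ j → u ≡ Λ′ j
        sound′ (here refl) = new , mem
        sound′ (there u∈) with ∈-advance⁻ u∈
        ... | v , v∈ , refl with sound v∈
        ...   | v≢ , j , refl = v≢ ∘ ∷-injectiveʳ , proj₁ (member-steady j) , sym (proj₂ (member-steady j))
        complete′ : ∀ j → Λ′ j ≢ Λ′ i → (e , Λ′ j) ∈ ((e , a ∷ w) ∷ advance ρ U)
        complete′ j j≢ with rest j j≢
        ... | inj₁ eq = here (cong (e ,_) eq)
        ... | inj₂ (≢i , kid≡) = there (subst (λ v → (e , v) ∈ advance ρ U) (sym (Λ′-steady kid≡))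
          (∈-advance⁺ (complete j ≢i)))

      Rest : Fin (suc k) → Node → Set
      Rest i v = ∀ j → Λ′ j ≢ Λ′ i → Λ′ j ≡ v ⊎ (Λ j ≢ Λ i × kid j ≡ ρ (Λ j))

      rest-steady : ∀ {i} → kid i ≡ ρ (Λ i) → Rest i (z ∷ node)
      rest-steady p j j≢ with role j
      ... | clone q q′ = inj₁ (Λ′-clone q q′)
      ... | steady q   = inj₂ ((λ eq → j≢ (trans (Λ′-steady q)
        (trans (cong (λ v → ρ v ∷ v) eq) (sym (Λ′-steady p))))) , q)

      rest-clone : ∀ {i} → Λ i ≡ node → kid i ≡ z → Rest i (ρ node ∷ node)
      rest-clone {i} i≡ p j j≢ with role j
      ... | clone q q′ = ⊥-elim (j≢ (trans (Λ′-clone q q′) (sym (Λ′-clone i≡ p))))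
      ... | steady q   = by-node (Λ j ≟ᴺ Λ i)
        where
        by-node : Dec (Λ j ≡ Λ i) → Λ′ j ≡ ρ node ∷ node ⊎ (Λ j ≢ Λ i × kid j ≡ ρ (Λ j))
        by-node (no n≢)  = inj₂ (n≢ , q)
        by-node (yes eq) = inj₁ (trans (Λ′-steady q) (cong (λ v → ρ v ∷ v) (trans eq i≡)))

      -- The newcomer is the twin `z ∷ node`, except for a member that sits there itself, whose
      -- newcomer is the sibling `ρ node ∷ node`. Its parent `node` belongs to the company of a
      -- member elsewhere, and is the member's own parent otherwise.
      company′ : ∀ i → Companion i
      company′ i = by-node (Λ i ≟ᴺ node) (role i)
        where
        same-level : length node ≡ length (Λ i)
        same-level = +-cancelʳ-≡ (suc h) _ _ (trans (level (inject₁ γ)) (sym (level i)))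
        by-node : Dec (Λ i ≡ node) → Role i → Companion i
        by-node (no n≢) _ = enlarge i (subst (λ l → z < size l) same-level z<)
          (λ complete → inj₂ (complete (inject₁ γ) (n≢ ∘ sym)))
          (λ eq → n≢ (sym (∷-injectiveʳ eq))) (proj₁ member-clone , sym (proj₂ member-clone))
          (rest-steady (kid-other n≢))
        by-node (yes i≡) (steady p) = enlarge i (subst (λ l → z < size l) same-level z<) (λ _ → inj₁ (sym i≡))
          (λ eq → z≢ (trans (∷-injectiveˡ eq) (trans p (cong ρ i≡))))
          (proj₁ member-clone , sym (proj₂ member-clone)) (rest-steady p)
        by-node (yes i≡) (clone _ p) = enlarge i (subst (λ l → ρ node < size l) same-level (valid node)) (λ _ → inj₁ (sym i≡))
          (λ eq → z≢ (sym (trans (∷-injectiveˡ eq) p)))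
          (proj₁ member-node , sym (proj₂ member-node)) (rest-clone i≡ p)

      H′ : Fin k → ℕ
      H′ g with g Fin.≟ γ
      ... | yes _ = 0
      ... | no  _ = suc (H g)

      γ-last : ∀ {g} → g ∈ gs → g <* γ
      γ-last g∈ with sorted
      ... | γ> ∷ _ = All.lookup γ> g∈

      sorted′ : AllPairs (λ g g′ → g′ <* g) gs
      sorted′ with sorted
      ... | _ ∷ sorted″ = sorted″

      still-opened : ∀ {g} → g ≢ γ → g ∉ gs → g ∉ (γ ∷ gs)
      still-opened g≢ g∉ (here eq)  = g≢ eq
      still-opened g≢ g∉ (there g∈) = g∉ g∈

      -- A gap still pending differs from `γ`, so both its ends lie on the same side of `γ`.
      closed′ : ∀ {g} → g ∈ gs → Λ′ (inject₁ g) ≡ Λ′ (Fin.suc g)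
      closed′ {g} g∈ = cong₂ _∷_ kids≡ (closed (there g∈))
        where
        g≢γ : toℕ g ≢ toℕ γ
        g≢γ eq = <*.irrefl (Fin.toℕ-injective eq) (γ-last g∈)
        closed-g : Λ (inject₁ g) ≡ Λ (Fin.suc g)
        closed-g = closed (there g∈)
        by-node : Dec (Λ (inject₁ g) ≡ node) → kid (inject₁ g) ≡ kid (Fin.suc g)
        by-node (no n≢) = trans (kid-other n≢) (trans (cong ρ closed-g) (sym (kid-other (n≢ ∘ trans closed-g))))
        by-node (yes eq) with <-cmp (toℕ g) (toℕ γ)
        ... | tri≈ _ g≡ _ = ⊥-elim (g≢γ g≡)
        ... | tri< lt _ _ = trans (kid-low eq (subst (_≤ toℕ γ) (sym (Fin.toℕ-inject₁ g)) (<⇒≤ lt)))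
          (sym (kid-low (trans (sym closed-g) eq) lt))
        ... | tri> _ _ gt = trans (kid-high eq (λ le → <⇒≱ gt (subst (_≤ toℕ γ) (Fin.toℕ-inject₁ g) le)))
          (sym (kid-high (trans (sym closed-g) eq) (λ lt → <-asym lt gt)))
        kids≡ : kid (inject₁ g) ≡ kid (Fin.suc g)
        kids≡ = by-node (Λ (inject₁ g) ≟ᴺ node)

      opened′ : ∀ {g} → g ∉ gs → Split (H′ g) (Λ′ (inject₁ g)) (Λ′ (Fin.suc g))
      opened′ {g} g∉ with g Fin.≟ γ
      ... | no n≢     = there (opened (still-opened n≢ g∉))
      ... | yes refl = subst₂ (Split 0) (sym (proj₂ member-low)) (sym (proj₂ member-high)) (here low<high)

      later′ : ∀ {g g′} → g ∈ gs → g′ ∉ gs → g <* g′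
      later′ {g} {g′} g∈ g′∉ with g′ Fin.≟ γ
      ... | no n≢     = later (there g∈) (still-opened n≢ g′∉)
      ... | yes refl = γ-last g∈

      -- Gaps are opened from the largest down, so `γ`, now of height 0, is the least one opened so
      -- far.
      ordered′ : ∀ {g g′} → g ∉ gs → g′ ∉ gs → g <* g′ → H′ g < H′ g′
      ordered′ {g} {g′} g∉ g′∉ lt with g Fin.≟ γ | g′ Fin.≟ γ
      ... | no n≢     | no n≢′    = s<s (ordered (still-opened n≢ g∉) (still-opened n≢′ g′∉) lt)
      ... | no n≢     | yes refl = ⊥-elim (<*.asym lt (later (here refl) (still-opened n≢ g∉)))
      ... | yes refl | no n≢′    = z<s
      ... | yes refl | yes refl = ⊥-elim (<*.irrefl refl lt)

      next : State h (e ∷ x) xs Λ′ gs H′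
      next = record
        { inside  = inside′
        ; level   = λ i → trans (sym (+-suc _ h)) (level i)
        ; len     = trans (sym (+-suc _ h)) len
        ; plan    = plan′
        ; mono    = mono′
        ; company = company′
        ; closed  = closed′
        ; opened  = opened′
        ; later   = later′
        ; ordered = ordered′
        ; sorted  = sorted′
        }

    occurrences : History → ℕ
    occurrences xs = length (filter (Fin._≟ e) xs)

    -- Each level of colour `e` opens one gap while any is pending, so enough remaining occurrences
    -- of `e` close the list by height 0.
    complete : ∀ h {x xs Λ gs H} → State h x xs Λ gs H → length gs ≤ occurrences xs →
      ∃₂ λ x′ Λ′ → ∃ λ H′ → State 0 x′ [] Λ′ [] H′
    complete zero {gs = gs} s le with State.plan s Fin.zero
    complete zero {gs = []} s le | refl = _ , _ , _ , s
    complete (suc h) {x} {[]} s le with () ← State.plan s Fin.zero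
    complete (suc h) {xs = a ∷ xs} s le with a Fin.≟ e
    ... | no _ = complete h (drift s) le
    complete (suc h) {xs = a ∷ xs} {gs = []} s le | yes refl = complete h (drift s) z≤n
    complete (suc h) {xs = a ∷ xs} {gs = γ ∷ gs} s le | yes refl =
      let z , z< , z≢ , z-node , z-other , z-plan = twin-exists s in
      complete h (Opening.next s z z< z≢ z-node z-other z-plan) (s≤s⁻¹ le)

-- Numerals in base b = 2 m ∸ 1 whose digits are less than m.  Such a base
-- makes the level at which two numerals part decide the size of their
-- difference.

module Numerals (m : ℕ) (m>0 : 0 < m) where

  b : ℕ
  b = 2 * m ∸ 1

  2m≡1+b : 2 * m ≡ suc b
  2m≡1+b = sym (m+[n∸m]≡n (≤-trans m>0 (m≤m+n m (m + 0))))

  value : Node → ℕ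
  value []      = 0
  value (d ∷ u) = d + b * value u

  Digits : Node → Set
  Digits = All (_< m)

  -- The choice of base is used here: twice a digit is at most `2 * m - 2`, one less than `b`.
  twice-digit : ∀ {d} → d < m → 2 * d < b
  twice-digit {d} d<m = s<s⁻¹ (s<s⁻¹ (begin-strict
    suc (suc (2 * d))  ≡⟨ *-suc 2 d ⟨
    2 * suc d          ≤⟨ *-monoʳ-≤ 2 d<m ⟩
    2 * m              ≡⟨ 2m≡1+b ⟩
    suc b              <⟨ n<1+n _ ⟩
    suc (suc b)        ∎))
    where open ≤-Reasoning

  value-< : ∀ {u} → Digits u → value u < b ^ length u
  value-< []                = s≤s z≤n
  value-< {d ∷ u} (d< ∷ ds) = begin-strict
    d + b * value u      ≤⟨ +-monoˡ-≤ (b * value u) (m≤m+n d (d + 0)) ⟩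
    2 * d + b * value u  <⟨ +-monoˡ-< (b * value u) (twice-digit d<) ⟩
    b + b * value u      ≡⟨ *-suc b (value u) ⟨
    b * suc (value u)    ≤⟨ *-monoʳ-≤ b (value-< ds) ⟩
    b * b ^ length u     ∎
    where open ≤-Reasoning

  twice-value : ∀ a u → 2 * value (a ∷ u) ≡ 2 * a + b * (2 * value u)
  twice-value a u = lemma a b (value u)
    where
    lemma : ∀ a b v → 2 * (a + b * v) ≡ 2 * a + b * (2 * v)
    lemma = solve-∀

  -- A lower digit changes the doubled difference by less than one unit of the next place. Together
  -- with `split-upper`, this puts the doubled difference strictly between `b ^ h` and `b ^ suc h`.
  split-lower : ∀ {h u v} → Split h u v → Digits u → 2 * value u + b ^ h < 2 * value v
  split-lower {u = d ∷ y} {d′ ∷ y} (here d<d′) _ = begin-strict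
    2 * (d + b * value y) + 1    <⟨ +-monoʳ-< (2 * (d + b * value y)) (s≤s (s≤s z≤n)) ⟩
    2 * (d + b * value y) + 2    ≡⟨ lemma d (b * value y) ⟩
    2 * (suc d + b * value y)    ≤⟨ *-monoʳ-≤ 2 (+-monoˡ-≤ (b * value y) d<d′) ⟩
    2 * (d′ + b * value y)       ∎
    where
    open ≤-Reasoning
    lemma : ∀ d w → 2 * (d + w) + 2 ≡ 2 * (suc d + w)
    lemma = solve-∀
  split-lower {suc h} {a ∷ u} {a′ ∷ v} (there s) (a< ∷ ds) = begin-strict
    2 * value (a ∷ u) + b * b ^ h          ≡⟨ cong (_+ b * b ^ h) (twice-value a u) ⟩
    2 * a + b * (2 * value u) + b * b ^ h  ≡⟨ lemma (2 * a) b (2 * value u) (b ^ h) ⟩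
    2 * a + b * (2 * value u + b ^ h)      <⟨ +-monoˡ-< (b * (2 * value u + b ^ h)) (twice-digit a<) ⟩
    b + b * (2 * value u + b ^ h)          ≡⟨ *-suc b (2 * value u + b ^ h) ⟨
    b * suc (2 * value u + b ^ h)          ≤⟨ *-monoʳ-≤ b (split-lower s ds) ⟩
    b * (2 * value v)                      ≤⟨ m≤n+m (b * (2 * value v)) (2 * a′) ⟩
    2 * a′ + b * (2 * value v)             ≡⟨ twice-value a′ v ⟨
    2 * value (a′ ∷ v)                     ∎
    where
    open ≤-Reasoning
    lemma : ∀ x b w p → x + b * w + b * p ≡ x + b * (w + p)
    lemma = solve-∀

  split-upper : ∀ {h u v} → Split h u v → Digits v → 2 * value v < 2 * value u + b ^ suc h
  split-upper {u = d ∷ y} {d′ ∷ y} (here d<d′) (d′< ∷ _) = begin-strict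
    2 * value (d′ ∷ y)               ≡⟨ twice-value d′ y ⟩
    2 * d′ + b * (2 * value y)       <⟨ +-monoˡ-< (b * (2 * value y)) (twice-digit d′<) ⟩
    b + b * (2 * value y)            ≤⟨ m≤n+m (b + b * (2 * value y)) (2 * d) ⟩
    2 * d + (b + b * (2 * value y))  ≡⟨ lemma (2 * d) b (b * (2 * value y)) ⟩
    2 * d + b * (2 * value y) + b * 1 ≡⟨ cong (_+ b * 1) (twice-value d y) ⟨
    2 * value (d ∷ y) + b * 1        ∎
    where
    open ≤-Reasoning
    lemma : ∀ x b w → x + (b + w) ≡ x + w + b * 1
    lemma = solve-∀
  split-upper {suc h} {a ∷ u} {a′ ∷ v} (there s) (a′< ∷ ds) = begin-strict
    2 * value (a′ ∷ v)                       ≡⟨ twice-value a′ v ⟩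
    2 * a′ + b * (2 * value v)               <⟨ +-monoˡ-< (b * (2 * value v)) (twice-digit a′<) ⟩
    b + b * (2 * value v)                    ≡⟨ *-suc b (2 * value v) ⟨
    b * suc (2 * value v)                    ≤⟨ *-monoʳ-≤ b (split-upper s ds) ⟩
    b * (2 * value u + b ^ suc h)            ≤⟨ m≤n+m _ (2 * a) ⟩
    2 * a + b * (2 * value u + b ^ suc h)    ≡⟨ lemma (2 * a) b (2 * value u) (b ^ suc h) ⟩
    2 * a + b * (2 * value u) + b * b ^ suc h ≡⟨ cong (_+ b * b ^ suc h) (twice-value a u) ⟨
    2 * value (a ∷ u) + b * b ^ suc h        ∎
    where
    open ≤-Reasoning
    lemma : ∀ x b w p → x + b * (w + p) ≡ x + b * w + b * p
    lemma = solve-∀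

  split-< : ∀ {h u v} → Split h u v → Digits u → value u < value v
  split-< {h} {u} {v} s ds = *-cancelˡ-< 2 (value u) (value v)
    (≤-<-trans (m≤m+n (2 * value u) (b ^ h)) (split-lower s ds))

  -- The ranges given by `split-lower` and `split-upper` for different heights do not overlap.
  differences-< : ∀ {h h′ u v u′ v′} → Split h u v → Split h′ u′ v′ → h < h′ →
    Digits v → Digits u′ → value v ∸ value u < value v′ ∸ value u′
  differences-< {h} {h′} {u} {v} {u′} {v′} s s′ h<h′ dv du′ = *-cancelˡ-< 2 _ _ (begin-strict
    2 * (value v ∸ value u)     ≡⟨ *-distribˡ-∸ 2 (value v) (value u) ⟩
    2 * value v ∸ 2 * value u   <⟨ m<n+o⇒m∸n<o (2 * value v) (2 * value u) {{>-nonZero b^>0}} (split-upper s dv) ⟩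
    b ^ suc h                   ≤⟨ ^-monoʳ-≤ b {{>-nonZero b>0}} h<h′ ⟩
    b ^ h′                      ≤⟨ m+n≤o⇒m≤o∸n (b ^ h′) (≤-trans (≤-reflexive (+-comm (b ^ h′) (2 * value u′))) (<⇒≤ (split-lower s′ du′))) ⟩
    2 * value v′ ∸ 2 * value u′ ≡⟨ *-distribˡ-∸ 2 (value v′) (value u′) ⟨
    2 * (value v′ ∸ value u′)   ∎)
    where
    open ≤-Reasoning
    b>0 : 0 < b
    b>0 = twice-digit m>0
    b^>0 : 0 < b ^ suc h
    b^>0 = m^n>0 b {{>-nonZero b>0}} (suc h)

-- Bounds on the branching numbers

n<2^n : ∀ n → n < 2 ^ n
n<2^n zero    = s≤s z≤n
n<2^n (suc n) = begin
  suc (suc n)       ≤⟨ +-mono-≤ (m^n>0 2 n) (n<2^n n) ⟩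
  2 ^ n + 2 ^ n     ≡⟨ cong (2 ^ n +_) (+-identityʳ (2 ^ n)) ⟨
  2 * 2 ^ n         ∎
  where open ≤-Reasoning

^-distribʳ-* : ∀ k a b → (a * b) ^ k ≡ a ^ k * b ^ k
^-distribʳ-* zero    a b = refl
^-distribʳ-* (suc k) a b = trans (cong (a * b *_) (^-distribʳ-* k a b)) (interchange a b (a ^ k) (b ^ k))
  where
  interchange : ∀ a b p q → a * b * (p * q) ≡ a * p * (b * q)
  interchange = solve-∀

-- From `c = 4` on, increasing `c` by one at most doubles the left side; the smaller values are
-- checked directly.
cubic≤exponential : ∀ c → c * c * suc c ≤ 12 * 2 ^ c
cubic≤exponential 0 = z≤n
cubic≤exponential 1 = ≤ᵇ⇒≤ 2 24 _
cubic≤exponential 2 = ≤ᵇ⇒≤ 12 48 _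
cubic≤exponential 3 = ≤ᵇ⇒≤ 36 96 _
cubic≤exponential (suc (suc (suc (suc j)))) = from-4 j
  where
  open ≤-Reasoning
  lemma : ∀ j → (5 + j) * ((5 + j) * (6 + j) + (2 + 5 * j + j * j)) ≡ 2 * ((4 + j) * (4 + j) * (5 + j))
  lemma = solve-∀
  swap : ∀ p → 2 * (12 * p) ≡ 12 * (2 * p)
  swap = solve-∀
  from-4 : ∀ j → (4 + j) * (4 + j) * (5 + j) ≤ 12 * 2 ^ (4 + j)
  from-4 zero    = ≤ᵇ⇒≤ 80 192 _
  from-4 (suc j) = begin
    (5 + j) * (5 + j) * (6 + j)           ≡⟨ *-assoc (5 + j) (5 + j) (6 + j) ⟩
    (5 + j) * ((5 + j) * (6 + j))         ≤⟨ *-monoʳ-≤ (5 + j) (m≤m+n ((5 + j) * (6 + j)) (2 + 5 * j + j * j)) ⟩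
    (5 + j) * ((5 + j) * (6 + j) + (2 + 5 * j + j * j)) ≡⟨ lemma j ⟩
    2 * ((4 + j) * (4 + j) * (5 + j))     ≤⟨ *-monoʳ-≤ 2 (from-4 j) ⟩
    2 * (12 * 2 ^ (4 + j))                ≡⟨ swap (2 ^ (4 + j)) ⟩
    12 * 2 ^ (5 + j)                      ∎

-- The nodes of level k will have 2 ^ (growth c ℓ * 3 ^ k) children; the base 3
-- makes this number equal to 2 ^ growth c ℓ times the square of the number of
-- nodes of level k.
growth : ℕ → ℕ → ℕ
growth c ℓ = ℓ * ℓ + (2 * c + c * c) * ℓ

-- With `P = (n + 1) ^ n` the right side is `3 * P ^ suc c`. One `P`, with the 3 and a factor
-- `2 ^ c`, absorbs `growth`; each of the other `c` absorbs `2 * 3 ^ n`.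
growth-bound : ∀ j c → let n = 3 + j in
  growth c (n * c) * 3 ^ (n * c) ≤ 3 * (n + 1) ^ ((c + 1) * n)
growth-bound j c = begin
  growth c (n * c) * 3 ^ (n * c)                        ≤⟨ *-monoˡ-≤ (3 ^ (n * c)) growth≤ ⟩
  3 * (P * 2 ^ c) * 3 ^ (n * c)                         ≡⟨ cong (3 * (P * 2 ^ c) *_) (^-*-assoc 3 n c) ⟨
  3 * (P * 2 ^ c) * (3 ^ n) ^ c                         ≡⟨ lemma P (2 ^ c) ((3 ^ n) ^ c) ⟩
  3 * (P * (2 ^ c * (3 ^ n) ^ c))                       ≡⟨ cong (λ z → 3 * (P * z)) (^-distribʳ-* c 2 (3 ^ n)) ⟨
  3 * (P * (2 * 3 ^ n) ^ c)                             ≤⟨ *-monoʳ-≤ 3 (*-monoʳ-≤ P (^-monoˡ-≤ c base≤)) ⟩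
  3 * P ^ suc c                                         ≡⟨ cong (3 *_) (^-*-assoc (n + 1) n (suc c)) ⟩
  3 * (n + 1) ^ (n * suc c)                             ≡⟨ cong (λ z → 3 * (n + 1) ^ z) (trans (*-comm n (suc c)) (cong (_* n) (+-comm 1 c))) ⟩
  3 * (n + 1) ^ ((c + 1) * n)                           ∎
  where
  open ≤-Reasoning
  n P : ℕ
  n = 3 + j
  P = (n + 1) ^ n
  lemma : ∀ p q r → 3 * (p * q) * r ≡ 3 * (p * (q * r))
  lemma = solve-∀
  4≤n+1 : 4 ≤ n + 1
  4≤n+1 = s≤s (s≤s (s≤s (m≤n+m 1 j)))
  n+1≢0 : NonZero (n + 1)
  n+1≢0 = >-nonZero (≤-trans (s≤s z≤n) 4≤n+1)
  -- For `n = 3` this reads `54 ≤ 64`; for `n = 2` it would be false.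
  base≤ : 2 * 3 ^ n ≤ P
  base≤ = begin
    2 * (3 ^ (3 + j))   ≡⟨ regroup (3 ^ j) ⟩
    54 * 3 ^ j          ≤⟨ *-mono-≤ (≤ᵇ⇒≤ 54 64 _) (^-monoˡ-≤ j (n≤1+n 3)) ⟩
    64 * 4 ^ j          ≡⟨ regroup′ (4 ^ j) ⟩
    4 ^ n               ≤⟨ ^-monoˡ-≤ n 4≤n+1 ⟩
    P                   ∎
    where
    regroup : ∀ p → 2 * (3 * (3 * (3 * p))) ≡ 54 * p
    regroup = solve-∀
    regroup′ : ∀ p → 64 * p ≡ 4 * (4 * (4 * p))
    regroup′ = solve-∀
  growth≤ : growth c (n * c) ≤ 3 * (P * 2 ^ c)
  growth≤ = begin
    -- The added terms complete the polynomial to a product.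
    growth c (n * c)                              ≤⟨ m≤m+n _ (c * c + c * c * c * (n * n + n + 1)) ⟩
    growth c (n * c) + (c * c + c * c * c * (n * n + n + 1)) ≡⟨ factor n c ⟩
    (n + 1) * (n + 1) * (c * c * suc c)           ≤⟨ *-monoʳ-≤ ((n + 1) * (n + 1)) (cubic≤exponential c) ⟩
    (n + 1) * (n + 1) * (12 * 2 ^ c)              ≡⟨ regroup ((n + 1) * (n + 1)) (2 ^ c) ⟩
    3 * (4 * ((n + 1) * (n + 1)) * 2 ^ c)         ≤⟨ *-monoʳ-≤ 3 (*-monoˡ-≤ (2 ^ c) (*-monoˡ-≤ ((n + 1) * (n + 1)) 4≤n+1)) ⟩
    3 * ((n + 1) * ((n + 1) * (n + 1)) * 2 ^ c)   ≡⟨ cong (λ z → 3 * ((n + 1) * ((n + 1) * z) * 2 ^ c)) (*-identityʳ (n + 1)) ⟨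
    3 * ((n + 1) ^ 3 * 2 ^ c)                     ≤⟨ *-monoʳ-≤ 3 (*-monoˡ-≤ (2 ^ c) (^-monoʳ-≤ (n + 1) {{n+1≢0}} (m≤m+n 3 j))) ⟩
    3 * (P * 2 ^ c)                               ∎
    where
    regroup : ∀ p q → p * (12 * q) ≡ 3 * (4 * p * q)
    regroup = solve-∀
    factor : ∀ n c → (n * c) * (n * c) + (2 * c + c * c) * (n * c) + (c * c + c * c * c * (n * n + n + 1)) ≡ (n + 1) * (n + 1) * (c * c * suc c)
    factor = solve-∀

-- A record, so that the exponents can be inferred.
record _≤2^_ (x a : ℕ) : Set where
  constructor power-bound
  field bound : x ≤ 2 ^ a

open _≤2^_

infixr 7 _⊛_
_⊛_ : ∀ {x y a b} → x ≤2^ a → y ≤2^ b → (x * y) ≤2^ (a + b)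
_⊛_ {a = a} {b} x≤ y≤ = power-bound
  (≤-trans (*-mono-≤ (bound x≤) (bound y≤)) (≤-reflexive (sym (^-distribˡ-+-* 2 a b))))

power : ∀ {x a} k → x ≤2^ a → (x ^ k) ≤2^ (a * k)
power {a = a} k x≤ = power-bound (≤-trans (^-monoˡ-≤ k (bound x≤)) (≤-reflexive (^-*-assoc 2 a k)))

-- Branching numbers large enough for the union bound

module Sizes (c ℓ : ℕ) where

  D : ℕ
  D = growth c ℓ

  size : ℕ → ℕ
  size k = 2 ^ (D * 3 ^ k)

  size>0 : ∀ k → 0 < size k
  size>0 k = m^n>0 2 (D * 3 ^ k)

  open Bounds c size

  -- The sum of `3 ^ j` over `j < k`, which is `(3 ^ k - 1) / 2`.
  t : ℕ → ℕ
  t zero    = 0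
  t (suc k) = t k + 3 ^ k

  3^k≡ : ∀ k → 3 ^ k ≡ suc (t k + t k)
  3^k≡ zero    = refl
  3^k≡ (suc k) = begin
    3 * 3 ^ k                          ≡⟨ lemma (3 ^ k) ⟩
    3 ^ k + (3 ^ k + 3 ^ k)            ≡⟨ cong (_+ (3 ^ k + 3 ^ k)) (3^k≡ k) ⟩
    suc (t k + t k) + (3 ^ k + 3 ^ k)  ≡⟨ lemma′ (t k) (3 ^ k) ⟩
    suc (t (suc k) + t (suc k))        ∎
    where
    open ≡-Reasoning
    lemma : ∀ p → 3 * p ≡ p + (p + p)
    lemma = solve-∀
    lemma′ : ∀ s p → suc (s + s) + (p + p) ≡ suc ((s + p) + (s + p))
    lemma′ = solve-∀

  width≡ : ∀ k → width k ≡ 2 ^ (D * t k)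
  width≡ zero    = cong (2 ^_) (sym (*-zeroʳ D))
  width≡ (suc k) = begin
    width k * size k                ≡⟨ cong (_* size k) (width≡ k) ⟩
    2 ^ (D * t k) * 2 ^ (D * 3 ^ k) ≡⟨ ^-distribˡ-+-* 2 (D * t k) (D * 3 ^ k) ⟨
    2 ^ (D * t k + D * 3 ^ k)       ≡⟨ cong (2 ^_) (*-distribˡ-+ D (t k) (3 ^ k)) ⟨
    2 ^ (D * t (suc k))             ∎
    where open ≡-Reasoning

  -- Each level multiplies the bound by at most `(2 + k) * size k`, and `2 + k ≤ 1 + ℓ ≤ 2 ^ ℓ`.
  companyBound-≤ : ∀ k → k ≤ ℓ → companyBound k ≤ (2 ^ ℓ) ^ k * width k
  companyBound-≤ zero    _   = ≤-refl
  companyBound-≤ (suc k) k<ℓ = begin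
    companyBound k * (1 + (1 + k) * size k)
      ≤⟨ *-mono-≤ (companyBound-≤ k (<⇒≤ k<ℓ)) (+-monoˡ-≤ ((1 + k) * size k) (size>0 k)) ⟩
    (2 ^ ℓ) ^ k * width k * (suc (1 + k) * size k)
      ≤⟨ *-monoʳ-≤ ((2 ^ ℓ) ^ k * width k) (*-monoˡ-≤ (size k) (≤-trans (s≤s k<ℓ) (n<2^n ℓ))) ⟩
    (2 ^ ℓ) ^ k * width k * (2 ^ ℓ * size k)
      ≡⟨ lemma ((2 ^ ℓ) ^ k) (width k) (2 ^ ℓ) (size k) ⟩
    2 ^ ℓ * (2 ^ ℓ) ^ k * (width k * size k) ∎
    where
    open ≤-Reasoning
    lemma : ∀ p w q s → p * w * (q * s) ≡ q * p * (w * s)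
    lemma = solve-∀

  -- Nodes and companies each contribute `D * t k` to the exponent. Since `D * 3 ^ k` is
  -- `D + 2 * D * t k`, the remaining factors must fit into `2 ^ D`; `growth` is defined
  -- accordingly.
  fits : ∀ {k} → k < ℓ → suc ℓ * (width k * levelBound k (ℓ ∸ suc k)) ≤ size k
  fits {k} k<ℓ = begin
    suc ℓ * (width k * levelBound k h)
      ≤⟨ bound (power-bound {a = ℓ} (n<2^n ℓ) ⊛ width≤ ⊛ power k c≤ ⊛ company≤ ⊛ power k c≤ ⊛ power c (power h c≤)) ⟩
    2 ^ (ℓ + (D * t k + (c * k + (ℓ * k + D * t k + (c * k + c * h * c)))))
      ≤⟨ ^-monoʳ-≤ 2 exponent≤ ⟩
    2 ^ (D * 3 ^ k) ∎
    where
    open ≤-Reasoning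
    h : ℕ
    h = ℓ ∸ suc k
    c≤ : c ≤2^ c
    c≤ = power-bound (<⇒≤ (n<2^n c))
    width≤ : width k ≤2^ (D * t k)
    width≤ = power-bound (≤-reflexive (width≡ k))
    company≤ : companyBound k ≤2^ (ℓ * k + D * t k)
    company≤ = power-bound (≤-trans (companyBound-≤ k (<⇒≤ k<ℓ)) (bound (power k (power-bound {a = ℓ} ≤-refl) ⊛ width≤)))
    regroup : ∀ ℓ d a b e → ℓ + (d + (a + (b + d + (a + e)))) ≡ d + d + (ℓ + b + (a + a + e))
    regroup = solve-∀
    regroup′ : ∀ c h → c * h * c ≡ c * c * h
    regroup′ = solve-∀
    regroup″ : ∀ ℓ c → ℓ * ℓ + (c * ℓ + c * ℓ + c * c * ℓ) ≡ ℓ * ℓ + (2 * c + c * c) * ℓ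
    regroup″ = solve-∀
    small≤ : ℓ + ℓ * k + (c * k + c * k + c * h * c) ≤ D
    small≤ = begin
      ℓ + ℓ * k + (c * k + c * k + c * h * c)
        ≡⟨ cong₂ (λ p q → p + (c * k + c * k + q)) (sym (*-suc ℓ k)) (regroup′ c h) ⟩
      ℓ * suc k + (c * k + c * k + c * c * h)
        ≤⟨ +-mono-≤ (*-monoʳ-≤ ℓ k<ℓ) (+-mono-≤ (+-mono-≤ (*-monoʳ-≤ c (<⇒≤ k<ℓ)) (*-monoʳ-≤ c (<⇒≤ k<ℓ)))
             (*-monoʳ-≤ (c * c) (m∸n≤m ℓ (suc k)))) ⟩
      ℓ * ℓ + (c * ℓ + c * ℓ + c * c * ℓ)
        ≡⟨ regroup″ ℓ c ⟩
      D ∎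
    exponent≤ : ℓ + (D * t k + (c * k + (ℓ * k + D * t k + (c * k + c * h * c)))) ≤ D * 3 ^ k
    exponent≤ = begin
      ℓ + (D * t k + (c * k + (ℓ * k + D * t k + (c * k + c * h * c))))
        ≡⟨ regroup ℓ (D * t k) (c * k) (ℓ * k) (c * h * c) ⟩
      D * t k + D * t k + (ℓ + ℓ * k + (c * k + c * k + c * h * c))
        ≤⟨ +-monoʳ-≤ (D * t k + D * t k) small≤ ⟩
      D * t k + D * t k + D
        ≡⟨ cong (_+ D) (*-distribˡ-+ D (t k) (t k)) ⟨
      D * (t k + t k) + D
        ≡⟨ +-comm (D * (t k + t k)) D ⟩
      D + D * (t k + t k)
        ≡⟨ *-suc D (t k + t k) ⟨
      D * suc (t k + t k)
        ≡⟨ cong (D *_) (3^k≡ k) ⟨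
      D * 3 ^ k ∎

-- Sorting the gaps, largest first, and finding a frequent colour

module Descending {k : ℕ} {_<*_ : Rel (Fin k) 0ℓ} (sto : IsStrictTotalOrder _≡_ _<*_) where

  private module <* = IsStrictTotalOrder sto

  Descends : List (Fin k) → Set
  Descends = AllPairs (λ g g′ → g′ <* g)

  insert : Fin k → List (Fin k) → List (Fin k)
  insert g []       = [ g ]
  insert g (x ∷ xs) with <*.compare x g
  ... | tri< _ _ _ = g ∷ x ∷ xs
  ... | tri≈ _ _ _ = x ∷ xs
  ... | tri> _ _ _ = x ∷ insert g xs

  ∈-insert-self : ∀ g xs → g ∈ insert g xs
  ∈-insert-self g []       = here refl
  ∈-insert-self g (x ∷ xs) with <*.compare x g
  ... | tri< _ _ _  = here refl
  ... | tri≈ _ eq _ = here (sym eq)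
  ... | tri> _ _ _  = there (∈-insert-self g xs)

  ∈-insert⁺ : ∀ {g g′} xs → g′ ∈ xs → g′ ∈ insert g xs
  ∈-insert⁺ {g} (x ∷ xs) g′∈ with <*.compare x g
  ... | tri< _ _ _ = there g′∈
  ... | tri≈ _ _ _ = g′∈
  ∈-insert⁺ {g} (x ∷ xs) (here eq)   | tri> _ _ _ = here eq
  ∈-insert⁺ {g} (x ∷ xs) (there g′∈) | tri> _ _ _ = there (∈-insert⁺ xs g′∈)

  insert-all : ∀ {P : Fin k → Set} {g} xs → P g → All P xs → All P (insert g xs)
  insert-all     []       Pg []         = Pg ∷ []
  insert-all {g = g} (x ∷ xs) Pg (Px ∷ Pxs) with <*.compare x g
  ... | tri< _ _ _ = Pg ∷ Px ∷ Pxs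
  ... | tri≈ _ _ _ = Px ∷ Pxs
  ... | tri> _ _ _ = Px ∷ insert-all xs Pg Pxs

  insert-descends : ∀ g xs → Descends xs → Descends (insert g xs)
  insert-descends g []       []         = [] ∷ []
  insert-descends g (x ∷ xs) (x> ∷ xs↘) with <*.compare x g
  ... | tri< x<g _ _ = (x<g ∷ All.map (λ y<x → <*.trans y<x x<g) x>) ∷ x> ∷ xs↘
  ... | tri≈ _ _ _   = x> ∷ xs↘
  ... | tri> _ _ g<x = insert-all xs g<x x> ∷ insert-descends g xs xs↘

  sort : List (Fin k) → List (Fin k)
  sort []       = []
  sort (g ∷ gs) = insert g (sort gs)

  sort-descends : ∀ gs → Descends (sort gs)
  sort-descends []       = []
  sort-descends (g ∷ gs) = insert-descends g (sort gs) (sort-descends gs)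

  ∈-sort : ∀ {g} gs → g ∈ gs → g ∈ sort gs
  ∈-sort (g ∷ gs) (here refl) = ∈-insert-self g (sort gs)
  ∈-sort (g ∷ gs) (there g∈)  = ∈-insert⁺ (sort gs) (∈-sort gs g∈)

  length-insert : ∀ g xs → length (insert g xs) ≤ suc (length xs)
  length-insert g []       = ≤-refl
  length-insert g (x ∷ xs) with <*.compare x g
  ... | tri< _ _ _ = ≤-refl
  ... | tri≈ _ _ _ = n≤1+n _
  ... | tri> _ _ _ = s≤s (length-insert g xs)

  length-sort : ∀ gs → length (sort gs) ≤ length gs
  length-sort []       = z≤n
  length-sort (g ∷ gs) = ≤-trans (length-insert g (sort gs)) (s≤s (length-sort gs))

-- The numbers of occurrences of the `c` colours add up to the length, so they cannot all be at most
-- `k`.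
frequent : ∀ {c} k (xs : List (Fin c)) → k * c < length xs →
  ∃ λ e → k < length (filter (Fin._≟ e) xs)
frequent {c} k xs lt with Fin.any? (λ e → k <? length (filter (Fin._≟ e) xs))
... | yes found = found
... | no ¬found = ⊥-elim (<⇒≱ lt (begin
  length xs                              ≡⟨ count xs ⟨
  sumOf (allFin c) (occ xs)              ≤⟨ sumOf-≤ (allFin c) (λ {e} _ → ≮⇒≥ (λ k< → ¬found (e , k<))) ⟩
  length (allFin c) * k                  ≡⟨ cong (_* k) (length-tabulate {n = c} id) ⟩
  c * k                                  ≡⟨ *-comm c k ⟩
  k * c                                  ∎))
  where
  open ≤-Reasoning
  occ : List (Fin c) → Fin c → ℕ
  occ xs e = length (filter (Fin._≟ e) xs)
  occ-∷ : ∀ x xs e → occ (x ∷ xs) e ≡ ⟦ x Fin.≟ e ⟧ + occ xs e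
  occ-∷ x xs e with x Fin.≟ e
  ... | yes _ = refl
  ... | no  _ = refl
  once : ∀ x → sumOf (allFin c) (λ e → ⟦ x Fin.≟ e ⟧) ≡ 1
  once x = ≤-antisym
    (sum-subsingleton (x Fin.≟_) (Unique.allFin⁺ c) (λ _ _ x≡v x≡w → trans (sym x≡v) x≡w))
    (≤-trans (≤-reflexive (⟦⟧-cong {P? = yes tt} {Q? = x Fin.≟ x} (λ _ → refl) (λ _ → tt)))
      (≤-sumOf (λ e → ⟦ x Fin.≟ e ⟧) (∈-allFin x)))
  count : ∀ xs → sumOf (allFin c) (occ xs) ≡ length xs
  count []       = trans (sumOf-const 0 (allFin c)) (*-zeroʳ (length (allFin c)))
  count (x ∷ xs) = trans (sumOf-cong (occ-∷ x xs) (allFin c))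
    (trans (sumOf-+ (λ e → ⟦ x Fin.≟ e ⟧) (occ xs) (allFin c)) (cong₂ _+_ (once x) (count xs)))

-- From colourings of 2-element subsets to colourings of numbers

∣p∣≡0⇒p≡∅ : ∀ {N} (p : Subset N) → ∣ p ∣ ≡ 0 → p ≡ ∅
∣p∣≡0⇒p≡∅ []ᵥ            _  = refl
∣p∣≡0⇒p≡∅ (outₛ ∷ᵥ p) eq = cong (outₛ ∷ᵥ_) (∣p∣≡0⇒p≡∅ p eq)

∣p∣≡1⇒singleton : ∀ {N} (p : Subset N) → ∣ p ∣ ≡ 1 → ∃ λ x → p ≡ ⁅ x ⁆
∣p∣≡1⇒singleton (inₛ  ∷ᵥ p) eq = Fin.zero , cong (inₛ ∷ᵥ_) (∣p∣≡0⇒p≡∅ p (suc-injective eq))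
∣p∣≡1⇒singleton (outₛ ∷ᵥ p) eq with ∣p∣≡1⇒singleton p eq
... | x , refl = Fin.suc x , refl

∣p∣≡2⇒pair : ∀ {N} (p : Subset N) → ∣ p ∣ ≡ 2 → ∃₂ λ x y → x ≢ y × p ≡ ⁅ x ⁆ ∪ ⁅ y ⁆
∣p∣≡2⇒pair (inₛ  ∷ᵥ p) eq with ∣p∣≡1⇒singleton p (suc-injective eq)
... | y , refl = Fin.zero , Fin.suc y , (λ ()) , cong (inₛ ∷ᵥ_) (sym (∪-identityˡ ⁅ y ⁆))
∣p∣≡2⇒pair (outₛ ∷ᵥ p) eq with ∣p∣≡2⇒pair p eq
... | x , y , x≢y , refl = Fin.suc x , Fin.suc y , x≢y ∘ Fin.suc-injective , refl

module PairColouring {N c : ℕ} (c₀ : Fin c) (f : [ N ]² → Fin c) where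

  -- The default `c₀` here, and `∅` in `singleton`, let `pairColour` be total on numbers, without
  -- proofs of distinctness or of bounds.
  colourOf : Subset N → Fin c
  colourOf p with ∣ p ∣ ≟ 2
  ... | yes eq = f (p , eq)
  ... | no  _  = c₀

  colourOf-f : ∀ s → colourOf (proj₁ s) ≡ f s
  colourOf-f (p , eq) with ∣ p ∣ ≟ 2
  ... | yes eq′ = cong (λ q → f (p , q)) (≡-irrelevant eq′ eq)
  ... | no  ≢2  = ⊥-elim (≢2 eq)

  singleton : ℕ → Subset N
  singleton u with u <? N
  ... | yes u<N = ⁅ fromℕ< u<N ⁆
  ... | no  _   = ∅

  singleton-fromℕ< : ∀ {u} (u<N : u < N) → singleton u ≡ ⁅ fromℕ< u<N ⁆
  singleton-fromℕ< {u} u<N with u <? N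
  ... | yes _   = refl
  ... | no  u≮N = ⊥-elim (u≮N u<N)

  pairColour : ℕ → ℕ → Fin c
  pairColour u v = colourOf (singleton u ∪ singleton v)

  pairColour-sym : ∀ u v → pairColour u v ≡ pairColour v u
  pairColour-sym u v = cong colourOf (∪-comm (singleton u) (singleton v))

-- From a suitable sequence of numbers to the conclusion

steps⇒increasing : ∀ {k} (v : Fin (suc k) → ℕ) → (∀ g → v (inject₁ g) < v (Fin.suc g)) →
  ∀ {i j} → i Fin.< j → v i < v j
steps⇒increasing {suc k} v step {Fin.zero}  {Fin.suc Fin.zero}    _   = step Fin.zero
steps⇒increasing {suc k} v step {Fin.zero}  {Fin.suc (Fin.suc j)} _   =
  <-trans (step Fin.zero) (steps⇒increasing (v ∘ Fin.suc) (step ∘ Fin.suc) {Fin.zero} {Fin.suc j} z<s)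
steps⇒increasing {suc k} v step {Fin.suc i} {Fin.suc j}           i<j =
  steps⇒increasing (v ∘ Fin.suc) (step ∘ Fin.suc) (s<s⁻¹ i<j)
steps⇒increasing {zero}  v step {Fin.zero}  {Fin.zero} ()

steps⇒injective : ∀ {k} (v : Fin (suc k) → ℕ) → (∀ g → v (inject₁ g) < v (Fin.suc g)) → Injective _≡_ _≡_ v
steps⇒injective v step {i} {j} eq with <-cmp (toℕ i) (toℕ j)
... | tri< lt _ _ = ⊥-elim (<-irrefl eq (steps⇒increasing v step lt))
... | tri≈ _ i≡ _ = Fin.toℕ-injective i≡
... | tri> _ _ gt = ⊥-elim (<-irrefl (sym eq) (steps⇒increasing v step gt))

Conclusion : ∀ {N c k} → ([ N ]² → Fin c) → Rel (Fin k) 0ℓ → Set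
Conclusion {N} {k = k} f _<*_ = ∃ λ (a : Fin (suc k) → Fin N) →
  (a Preserves Fin._<_ ⟶ Fin._<_) ×
  ConstantOnPairs f (Range a) ×
  Injective _≡_ _≡_ (difference a) ×
  (difference a Preserves _<*_ ⟶ _<_)

conclude : ∀ {N c k} (c₀ : Fin c) (f : [ N ]² → Fin c) {_<*_ : Rel (Fin k) 0ℓ} → IsStrictTotalOrder _≡_ _<*_ →
  let open PairColouring c₀ f in
  (v : Fin (suc k) → ℕ) → (∀ i → v i < N) → (∀ g → v (inject₁ g) < v (Fin.suc g)) →
  ∀ e → (∀ i j → i ≢ j → pairColour (v i) (v j) ≡ e) →
  (∀ {g g′} → g <* g′ → v (Fin.suc g) ∸ v (inject₁ g) < v (Fin.suc g′) ∸ v (inject₁ g′)) →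
  Conclusion f _<*_
conclude {N} {c} {k} c₀ f {_<*_} sto v v<N step e same gaps = a , increasing , constant , injective , ordered
  where
  open PairColouring c₀ f
  module <* = IsStrictTotalOrder sto
  a : Fin (suc k) → Fin N
  a i = fromℕ< (v<N i)
  toℕ-a : ∀ i → toℕ (a i) ≡ v i
  toℕ-a i = Fin.toℕ-fromℕ< (v<N i)
  increasing : a Preserves Fin._<_ ⟶ Fin._<_
  increasing {i} {j} i<j = subst₂ _<_ (sym (toℕ-a i)) (sym (toℕ-a j)) (steps⇒increasing v step i<j)
  f-constant : ∀ s → (∀ {x} → x ∈ₛ proj₁ s → Range a x) → f s ≡ e
  f-constant (p , eq) p⊆ with ∣p∣≡2⇒pair p eq
  ... | x , y , x≢y , refl with p⊆ (x∈p∪q⁺ (inj₁ (x∈⁅x⁆ x))) | p⊆ (x∈p∪q⁺ {p = ⁅ x ⁆} (inj₂ (x∈⁅x⁆ y)))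
  ...   | i , refl | j , refl = begin
    f (⁅ a i ⁆ ∪ ⁅ a j ⁆ , eq)      ≡⟨ colourOf-f (⁅ a i ⁆ ∪ ⁅ a j ⁆ , eq) ⟨
    colourOf (⁅ a i ⁆ ∪ ⁅ a j ⁆)    ≡⟨ cong₂ (λ p q → colourOf (p ∪ q)) (singleton-fromℕ< (v<N i)) (singleton-fromℕ< (v<N j)) ⟨
    pairColour (v i) (v j)          ≡⟨ same i j (λ i≡j → x≢y (cong a i≡j)) ⟩
    e                               ∎
    where open ≡-Reasoning
  constant : ConstantOnPairs f (Range a)
  constant s t s⊆ t⊆ = trans (f-constant s s⊆) (sym (f-constant t t⊆))
  ordered : difference a Preserves _<*_ ⟶ _<_
  ordered {g} {g′} g<g′ = subst₂ _<_ (diff≡ g) (diff≡ g′) (gaps g<g′)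
    where
    diff≡ : ∀ g → v (Fin.suc g) ∸ v (inject₁ g) ≡ difference a g
    diff≡ g = cong₂ _∸_ (sym (toℕ-a (Fin.suc g))) (sym (toℕ-a (inject₁ g)))
  injective : Injective _≡_ _≡_ (difference a)
  injective {g} {g′} eq with <*.compare g g′
  ... | tri< lt _ _ = ⊥-elim (<-irrefl eq (ordered lt))
  ... | tri≈ _ g≡ _ = g≡
  ... | tri> _ _ gt = ⊥-elim (<-irrefl (sym eq) (ordered gt))

-- Reading the leaves of the tree as numerals

module Main (c : ℕ) (c₀ : Fin c) (size : ℕ → ℕ) (size>0 : ∀ k → 0 < size k) (ℓ k m : ℕ) (m>0 : 0 < m)
  (kc<ℓ : k * c < ℓ) (size≤m : ∀ {j} → j < ℓ → size j ≤ m)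
  (f : [ (2 * m ∸ 1) ^ ℓ ]² → Fin c) {_<*_ : Rel (Fin k) 0ℓ} (sto : IsStrictTotalOrder _≡_ _<*_) where

  open Numerals m m>0
  open PairColouring c₀ f

  F : Node → Node → Fin c
  F u v = pairColour (value u) (value v)

  open Bounds c size
  open Tree c c₀ size F
  open Counting c c₀ size F size>0 ℓ
  open Growing c c₀ size F size>0 ℓ
  open Descending sto

  digits : ∀ y → length y ≤ ℓ → Inside y → Digits y
  digits []      _   _           = []
  digits (d ∷ y) y<ℓ (d< , in-y) = <-≤-trans d< (size≤m y<ℓ) ∷ digits y (<⇒≤ y<ℓ) in-y

  gaps : List (Fin k)
  gaps = sort (allFin k)

  module Realise (ρ : Rep) (valid : ∀ u → ρ u < size (length u))
    (repeated : ∀ y → Inside y → length y < ℓ → AllRepeated ρ y)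
    (e : Fin c) (k<occ : k < length (filter (Fin._≟ e) (schedule ρ ℓ [] []))) where

    open Build (λ u v → pairColour-sym (value u) (value v)) ρ valid repeated sto e

    all-pending : ∀ g → g ∈ gaps
    all-pending g = ∈-sort (allFin k) (∈-allFin g)
    -- All members begin at the root with every gap pending, so the conditions on opened gaps are
    -- vacuous.
    start : State ℓ [] (schedule ρ ℓ [] []) (λ _ → []) gaps (λ _ → 0)
    start = record
      { inside  = λ _ → tt
      ; level   = λ _ → refl
      ; len     = refl
      ; plan    = λ _ → refl
      ; mono    = λ _ _ n≢ → ⊥-elim (n≢ refl)
      ; company = λ _ → [] , here refl , (λ ()) , λ _ n≢ → ⊥-elim (n≢ refl)
      ; closed  = λ _ → refl
      ; opened  = λ g∉ → ⊥-elim (g∉ (all-pending _))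
      ; later   = λ _ g∉ → ⊥-elim (g∉ (all-pending _))
      ; ordered = λ g∉ → ⊥-elim (g∉ (all-pending _))
      ; sorted  = sort-descends (allFin k)
      }
    enough : length gaps ≤ occurrences (schedule ρ ℓ [] [])
    enough = ≤-trans (length-sort (allFin k)) (≤-trans (≤-reflexive (length-tabulate {n = k} id)) (<⇒≤ k<occ))
    realise : (∃₂ λ x Λ → ∃ λ H → State 0 x [] Λ [] H) → Conclusion f _<*_
    realise (x , Λ , H , s) = conclude c₀ f sto (value ∘ Λ)
      (λ i → subst (λ l → value (Λ i) < b ^ l) (level≡ i) (value-< (Λ-digits i)))
      step e (λ i j i≢j → mono i j (λ eq → i≢j (steps⇒injective (value ∘ Λ) step (cong value eq))))
      (λ {g} {g′} g<g′ → differences-< (opened (λ ())) (opened (λ ())) (ordered (λ ()) (λ ()) g<g′)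
        (Λ-digits (Fin.suc g)) (Λ-digits (inject₁ g′)))
      where
      open State s
      level≡ : ∀ i → length (Λ i) ≡ ℓ
      level≡ i = trans (sym (+-identityʳ _)) (level i)
      Λ-digits : ∀ i → Digits (Λ i)
      Λ-digits i = digits (Λ i) (≤-reflexive (level≡ i)) (inside i)
      step : ∀ g → value (Λ (inject₁ g)) < value (Λ (Fin.suc g))
      step g = split-< (opened (λ ())) (Λ-digits (inject₁ g))

    result : Conclusion f _<*_
    result = realise (complete ℓ start enough)

  conclusion : (∀ {j} → j < ℓ → suc ℓ * (width j * levelBound j (height j)) ≤ size j) → Conclusion f _<*_
  conclusion fits = realise (good-choice fits)
    where
    realise : (∃ λ ρ → (∀ u → ρ u < size (length u)) × (∀ y → Inside y → length y < ℓ → AllRepeated ρ y)) →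
      Conclusion f _<*_
    realise (ρ , valid , repeated) = Realise.result ρ valid repeated (proj₁ frequent-colour) (proj₂ frequent-colour)
      where
      frequent-colour : ∃ λ e → k < length (filter (Fin._≟ e) (schedule ρ ℓ [] []))
      frequent-colour = frequent k (schedule ρ ℓ [] []) (subst (k * c <_) (sym (length-schedule ρ ℓ [] [])) kc<ℓ)

theorem-small : ∀ {N c k} (c₀ : Fin c) (f : [ N ]² → Fin c) {_<*_ : Rel (Fin k) 0ℓ} →
  IsStrictTotalOrder _≡_ _<*_ → k ≤ 1 → k < N → Conclusion f _<*_
theorem-small {N} {c} {k} c₀ f {_<*_} sto k≤1 k<N = conclude c₀ f sto toℕ
  (λ i → <-≤-trans (Fin.toℕ<n i) k<N)
  (λ g → s≤s (≤-reflexive (Fin.toℕ-inject₁ g)))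
  (pairColour 0 1) (colours k≤1)
  (λ {g} {g′} g<g′ → ⊥-elim (<*.irrefl (unique k≤1 g g′) g<g′))
  where
  open PairColouring c₀ f
  module <* = IsStrictTotalOrder sto
  unique : ∀ {k} → k ≤ 1 → (g g′ : Fin k) → g ≡ g′
  unique (s≤s z≤n) Fin.zero Fin.zero = refl
  colours : ∀ {k} → k ≤ 1 → (i j : Fin (suc k)) → i ≢ j → pairColour (toℕ i) (toℕ j) ≡ pairColour 0 1
  colours _         Fin.zero           Fin.zero           i≢j = ⊥-elim (i≢j refl)
  colours (s≤s z≤n) Fin.zero           (Fin.suc Fin.zero) _   = refl
  colours (s≤s z≤n) (Fin.suc Fin.zero) Fin.zero           _   = pairColour-sym 1 0
  colours (s≤s z≤n) (Fin.suc Fin.zero) (Fin.suc Fin.zero) i≢j = ⊥-elim (i≢j refl)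

-- Final estimates and the theorem

2≤2^ : ∀ a → 0 < a → 2 ≤ 2 ^ a
2≤2^ (suc a) _ = *-monoʳ-≤ 2 (m^n>0 2 a)

1<base^ : ∀ {m ℓ} → 2 ≤ m → 0 < ℓ → 1 < (2 * m ∸ 1) ^ ℓ
1<base^ {m} {suc ℓ} 2≤m _ = begin-strict
  1           <⟨ 3≤b ⟩
  b           ≡⟨ *-identityʳ b ⟨
  b * 1       ≤⟨ *-monoʳ-≤ b (m^n>0 b {{>-nonZero (<⇒≤ 3≤b)}} ℓ) ⟩
  b * b ^ ℓ   ∎
  where
  open ≤-Reasoning
  b : ℕ
  b = 2 * m ∸ 1
  3≤b : 2 ≤ b
  3≤b = ≤-trans (n≤1+n 2) (∸-monoˡ-≤ 1 (*-monoʳ-≤ 2 2≤m))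

-- After multiplying the exponents by 3, `3 ^ suc j ≤ 3 ^ ℓ` leads to `growth-bound`.
size-bound : ∀ i c {j} → let n = 3 + i; ℓ = n * c in j < ℓ →
  2 ^ (growth c ℓ * 3 ^ j) ≤ 2 ^ ((n + 1) ^ ((c + 1) * n))
size-bound i c {j} j<ℓ = ^-monoʳ-≤ 2 {growth c ℓ * 3 ^ j} {(n + 1) ^ ((c + 1) * n)} (*-cancelˡ-≤ 3 (begin
  3 * (growth c ℓ * 3 ^ j)         ≡⟨ lemma (growth c ℓ) (3 ^ j) ⟩
  growth c ℓ * 3 ^ suc j           ≤⟨ *-monoʳ-≤ (growth c ℓ) (^-monoʳ-≤ 3 j<ℓ) ⟩
  growth c ℓ * 3 ^ ℓ               ≤⟨ growth-bound i c ⟩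
  3 * (n + 1) ^ ((c + 1) * n)      ∎))
  where
  open ≤-Reasoning
  n ℓ : ℕ
  n = 3 + i
  ℓ = n * c
  lemma : ∀ g p → 3 * (g * p) ≡ g * (3 * p)
  lemma = solve-∀

mainTheorem1 : (n c : ℕ) → 1 ≤ n → 1 ≤ c →
    let ℓ = n * c
        m = 2 ^ ((n + 1) ^ ((c + 1) * n))
        N = (2 * m ∸ 1) ^ ℓ
    in
    (f : [ N ]² → Fin c) →
    (_<*_ : Rel (Fin (pred n)) 0ℓ) → IsStrictTotalOrder _≡_ _<*_ →
    ∃ λ (a : Fin n → Fin N) →
      (a Preserves Fin._<_ ⟶ Fin._<_) ×
      ConstantOnPairs f (Range a) ×
      Injective _≡_ _≡_ (difference a) ×
      (difference a Preserves _<*_ ⟶ _<_)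
mainTheorem1 (suc k) (suc c) _ _ f _<*_ sto with k ≤? 1
... | yes k≤1 = theorem-small Fin.zero f sto k≤1 (≤-<-trans k≤1
  (1<base^ {2 ^ E} {suc k * suc c} (2≤2^ E (m^n>0 (suc k + 1) ((suc c + 1) * suc k))) z<s))
  where
  E : ℕ
  E = (suc k + 1) ^ ((suc c + 1) * suc k)
mainTheorem1 (suc zero)          (suc c) _ _ f _<*_ sto | no k≰1 = ⊥-elim (k≰1 z≤n)
mainTheorem1 (suc (suc zero))    (suc c) _ _ f _<*_ sto | no k≰1 = ⊥-elim (k≰1 ≤-refl)
mainTheorem1 (suc (suc (suc i))) (suc c) _ _ f _<*_ sto | no _ =
  Main.conclusion (suc c) Fin.zero size size>0 ((3 + i) * suc c) (2 + i) (2 ^ E)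
    (m^n>0 2 E) (m<n+m ((2 + i) * suc c) z<s) (size-bound i (suc c)) f sto fits
  where
  open Sizes (suc c) ((3 + i) * suc c)
  E : ℕ
  E = (3 + i + 1) ^ ((suc c + 1) * (3 + i))
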